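{- Let $k\in\mathbb{N}$. There is a constant $C_k>0$ depending only on $k$ such that for every $n\in\mathbb{N}$ and every family $\mathcal{A}\subset\mathcal{P}[n]$ of subsets of $[n]=\{1,\ldots,n\}$ with $|A\setminus B|\neq k$ for all $A,B\in\mathcal{A}$, we have \[ |\mathcal{A}| \le \frac{C_k}{n^k}\binom{n}{\lfloor n/2\rfloor}. \]
   Context: $\mathcal{P}[n]$ denotes the power set of $[n]=\{1,\ldots,n\}$. -}

module Defs where

open import Data.Nat using (ℕ)
open import Data.List using (List)
open import Data.List.Membership.Propositional using (_∈_)
open import Data.List.Relation.Unary.Unique.Propositional using (Unique)
open import Data.Fin.Subset using (Subset; _─_; ∣_∣)
open import Relation.Binary.PropositionalEquality using (_≢_)

-- A family 𝒜 ⊆ 𝒫[n] is a duplicate-free list of subsets of Fin n;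
-- its cardinality is the length of the list.

AvoidsDiff : {n : ℕ} → ℕ → List (Subset n) → Set
AvoidsDiff k 𝒜 = ∀ {A B} → A ∈ 𝒜 → B ∈ 𝒜 → ∣ A ─ B ∣ ≢ k

{-# OPTIONS --safe #-}
module Submission where

-- By complementation all members may be assumed to have size at most n / 2.  Take a random word of
-- L + j distinct letters, z of length L followed by x of length j, and let S_t consist of x and the
-- first t letters of z.  For t ranging over a sparse set of positions, count the t with S_t in the
-- family, the "hits".
--
-- Local bound: for fixed T at most c n^(j-k) of the j-tuples y outside T have T ∪ y in the family.  It
-- also holds for the union of the hits over all members T of a chain, since a pair of tuples differing
-- in exactly k fresh entries gives a difference of size k for any two members of the chain.  Hence the
-- expected number of first hits is O(n^(-k)).  Given a hit at t, the bound applied to the j letters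
-- before a later position t′ shows that t′ is a hit with probability O(n^(-k)), so if there are at most
-- ε n positions, at least half of the hits are first ones, and Σ 1 / (n C |A|) over the family is O(n^(-k)).
--
-- The local bound: call a set V of coordinates movable at x in Φ if x can be changed inside Φ exactly on
-- V, to values avoiding any j prescribed ones.  All but O(n^(j-k)) tuples of Φ have a movable set inside
-- every k-set of coordinates.  A maximal set of coordinates free of movable ones then yields, by
-- pigeonhole, a set G with |G| < k such that G ∪ {y} is movable for at least k coordinates y.
-- Passing repeatedly to the tuples with the most frequent G, one finds a walk of k - |G| moves with the
-- same G, whose ends differ in exactly k fresh entries.

open import Defs
open import Data.Nat using (ℕ; zero; suc; _+_; _*_; _∸_; _^_; _≤_; _<_; _/_; _%_; _!; z≤n; s≤s; s≤s⁻¹; _≤?_; _<?_; _≟_; NonZero; >-nonZero)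
open import Data.Nat.Properties
open import Data.Nat.Combinatorics using (_C_; k![n∸k]!∣n!)
open import Data.Nat.Combinatorics.Specification using (nCk≡n!/k![n-k]!)
open import Data.Nat.DivMod using (m≡m%n+[m/n]*n; m/n*n≡m; m/n*n≤m; m%n<n; /-monoˡ-≤; m*n/n≡m)
open import Data.Nat.Solver using (module +-*-Solver)
open import Data.List using (List; []; _∷_; _++_; map; concatMap; length; allFin; filter; take; downFrom; tabulate)
open import Data.List.Properties using (length-tabulate; map-tabulate; length-++; length-map; ++-assoc; take-all)
open import Data.List.Membership.Propositional using (lose; find) renaming (_∈_ to _∈ˡ_)
open import Data.List.Membership.Propositional.Properties using (∈-map⁺; ∈-map⁻; ∈-concatMap⁺; ∈-allFin; ∈-++⁺ˡ; ∈-++⁺ʳ; ∈-++⁻; ∈-filter⁻; ∈-downFrom⁺; ∈-downFrom⁻)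
import Data.List.Membership.DecPropositional as DecMembership
open import Data.List.Relation.Unary.Any using (Any; here; there; any?)
open import Data.List.Relation.Unary.All using (all?)
import Data.List.Relation.Unary.All as All
open import Data.List.Relation.Unary.AllPairs using ([]; _∷_)
open import Data.List.Relation.Unary.Unique.Propositional using (Unique)
open import Data.List.Relation.Unary.Unique.Propositional.Properties using (allFin⁺; filter⁺; map⁺)
open import Data.Vec using (Vec; []; _∷_; lookup; _[_]≔_; toList; here; there)
open import Data.Vec.Properties using (lookup∘update; lookup∘update′; []≔-idempotent; []≔-lookup; ≡-dec; []=⇒lookup; lookup⇒[]=; length-toList)
open import Data.Fin using (Fin; zero; suc)
import Data.Fin.Properties as Fin
open import Data.Fin.Subset using (Subset; ∣_∣; inside; outside; ⊥; ⊤; _∈_; _∉_; _⊆_; _∪_; _─_; ⁅_⁆; ∁)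
open import Data.Fin.Subset.Properties using (∣⊥∣≡0; ∣p∣≤n; ∣p∣≡n⇒p≡⊤; ∣∁p∣≡n∸∣p∣; ∉⊥; ∈⊤; x∈⁅x⁆; x∈⁅y⁆⇒x≡y; ⊆-antisym; x∈p⇒x∉∁p; x∈∁p⇒x∉p; x∉∁p⇒x∈p; ∪-assoc; ∪-comm; ∪-identityˡ; ∪-identityʳ; x∈p∪q⁻; x∈p∪q⁺; p⊆p∪q; p─q⊆p; x∈p∧x∉q⇒x∈p─q; _∈?_)
open import Data.Bool using (Bool; true; false)
import Data.Bool.Properties as Bool
open import Data.Product using (∃; _×_; _,_; proj₁; proj₂)
open import Data.Sum using (inj₁; inj₂)
open import Data.Empty using (⊥-elim)
open import Function using (_∘_)
open import Relation.Nullary using (¬_; Dec; yes; no)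
open import Relation.Nullary.Decidable using (map′; _×-dec_; _→-dec_; ¬?; decidable-stable)
open import Relation.Unary using (Decidable)
open import Relation.Binary using (DecidableEquality)
open import Relation.Binary.PropositionalEquality using (_≡_; _≢_; refl; sym; trans; cong; cong₂; subst; subst₂; module ≡-Reasoning)

private variable
  X Y : Set
  j n k l : ℕ

-- Indicators and finite sums

ind : {P : Set} → Dec P → ℕ
ind (yes _) = 1
ind (no _)  = 0

ind≤1 : {P : Set} (d : Dec P) → ind d ≤ 1
ind≤1 (yes _) = ≤-refl
ind≤1 (no _)  = z≤n

ind-yes : {P : Set} (d : Dec P) → P → ind d ≡ 1
ind-yes (yes _) _ = refl
ind-yes (no ¬p) p = ⊥-elim (¬p p)

ind-no : {P : Set} (d : Dec P) → ¬ P → ind d ≡ 0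
ind-no (yes p) ¬p = ⊥-elim (¬p p)
ind-no (no _)  _  = refl

ind-mono : {P Q : Set} (d : Dec P) (e : Dec Q) → (P → Q) → ind d ≤ ind e
ind-mono (yes p) e f = ≤-reflexive (sym (ind-yes e (f p)))
ind-mono (no _)  e f = z≤n

ind-≤ : {P : Set} (d : Dec P) {m : ℕ} → (P → 1 ≤ m) → ind d ≤ m
ind-≤ (yes p) f = f p
ind-≤ (no _)  f = z≤n

∑ : List X → (X → ℕ) → ℕ
∑ []       f = 0
∑ (x ∷ xs) f = f x + ∑ xs f

∑-mono-∈ : (xs : List X) {f g : X → ℕ} → (∀ {x} → x ∈ˡ xs → f x ≤ g x) → ∑ xs f ≤ ∑ xs g
∑-mono-∈ []       h = z≤n
∑-mono-∈ (x ∷ xs) h = +-mono-≤ (h (here refl)) (∑-mono-∈ xs (h ∘ there))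

∑-mono : (xs : List X) {f g : X → ℕ} → (∀ x → f x ≤ g x) → ∑ xs f ≤ ∑ xs g
∑-mono xs h = ∑-mono-∈ xs (λ {x} _ → h x)

∑-cong : (xs : List X) {f g : X → ℕ} → (∀ x → f x ≡ g x) → ∑ xs f ≡ ∑ xs g
∑-cong []       h = refl
∑-cong (x ∷ xs) h = cong₂ _+_ (h x) (∑-cong xs h)

∑-mono-< : (xs : List X) {f g : X → ℕ} → (∀ x → f x ≤ g x) →
           ∀ {x} → x ∈ˡ xs → f x < g x → ∑ xs f < ∑ xs g
∑-mono-< (x ∷ xs) h (here refl) lt = +-mono-<-≤ lt (∑-mono xs h)
∑-mono-< (x ∷ xs) h (there m)   lt = +-mono-≤-< (h x) (∑-mono-< xs h m lt)

∑-member : (xs : List X) (f : X → ℕ) {x : X} → x ∈ˡ xs → f x ≤ ∑ xs f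
∑-member (x ∷ xs) f (here refl) = m≤m+n (f x) _
∑-member (y ∷ xs) f (there m)   = ≤-trans (∑-member xs f m) (m≤n+m _ (f y))

+-interchange : ∀ a b c d → (a + b) + (c + d) ≡ (a + c) + (b + d)
+-interchange = solve 4 (λ a b c d → (a :+ b) :+ (c :+ d) := (a :+ c) :+ (b :+ d)) refl
  where open +-*-Solver

∑-+ : (xs : List X) (f g : X → ℕ) → ∑ xs (λ x → f x + g x) ≡ ∑ xs f + ∑ xs g
∑-+ []       f g = refl
∑-+ (x ∷ xs) f g = trans (cong (f x + g x +_) (∑-+ xs f g)) (+-interchange (f x) (g x) _ _)

∑-*ˡ : (xs : List X) (c : ℕ) (f : X → ℕ) → ∑ xs (λ x → c * f x) ≡ c * ∑ xs f
∑-*ˡ []       c f = sym (*-zeroʳ c)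
∑-*ˡ (x ∷ xs) c f = trans (cong (c * f x +_) (∑-*ˡ xs c f)) (sym (*-distribˡ-+ c (f x) _))

∑-*ʳ : (xs : List X) (c : ℕ) (f : X → ℕ) → ∑ xs (λ x → f x * c) ≡ ∑ xs f * c
∑-*ʳ xs c f = trans (∑-cong xs (λ x → *-comm (f x) c)) (trans (∑-*ˡ xs c f) (*-comm c _))

∑-const : (xs : List X) (c : ℕ) → ∑ xs (λ _ → c) ≡ length xs * c
∑-const []       c = refl
∑-const (x ∷ xs) c = cong (c +_) (∑-const xs c)

∑-zero : (xs : List X) → ∑ xs (λ _ → 0) ≡ 0
∑-zero xs = trans (∑-const xs 0) (*-zeroʳ (length xs))

length-∑ : (xs : List X) → length xs ≡ ∑ xs (λ _ → 1)
length-∑ xs = sym (trans (∑-const xs 1) (*-identityʳ _))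

∑-≤-const : (xs : List X) {f : X → ℕ} (c : ℕ) → (∀ {x} → x ∈ˡ xs → f x ≤ c) → ∑ xs f ≤ length xs * c
∑-≤-const xs c h = ≤-trans (∑-mono-∈ xs h) (≤-reflexive (∑-const xs c))

∑-swap : (xs : List X) (ys : List Y) (f : X → Y → ℕ) →
         ∑ xs (λ x → ∑ ys (f x)) ≡ ∑ ys (λ y → ∑ xs (λ x → f x y))
∑-swap []       ys f = sym (∑-zero ys)
∑-swap (x ∷ xs) ys f = trans (cong (∑ ys (f x) +_) (∑-swap xs ys f)) (sym (∑-+ ys (f x) _))

∑-++ : (xs ys : List X) (f : X → ℕ) → ∑ (xs ++ ys) f ≡ ∑ xs f + ∑ ys f
∑-++ []       ys f = refl
∑-++ (x ∷ xs) ys f = trans (cong (f x +_) (∑-++ xs ys f)) (sym (+-assoc (f x) _ _))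

∑-map : (h : X → Y) (xs : List X) (f : Y → ℕ) → ∑ (map h xs) f ≡ ∑ xs (f ∘ h)
∑-map h []       f = refl
∑-map h (x ∷ xs) f = cong (f (h x) +_) (∑-map h xs f)

∑-concatMap : (h : X → List Y) (xs : List X) (f : Y → ℕ) →
              ∑ (concatMap h xs) f ≡ ∑ xs (λ x → ∑ (h x) f)
∑-concatMap h []       f = refl
∑-concatMap h (x ∷ xs) f = trans (∑-++ (h x) _ f) (cong (∑ (h x) f +_) (∑-concatMap h xs f))

length-filter-∑ : {P : X → Set} (P? : Decidable P) (xs : List X) →
                  length (filter P? xs) ≡ ∑ xs (λ x → ind (P? x))
length-filter-∑ P? []       = refl
length-filter-∑ P? (x ∷ xs) with P? x
... | yes _ = cong suc (length-filter-∑ P? xs)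
... | no _  = length-filter-∑ P? xs

∑-member-pos : (xs : List X) (f : X → ℕ) {x : X} → x ∈ˡ xs → 1 ≤ f x → 1 ≤ ∑ xs f
∑-member-pos xs f m h = ≤-trans h (∑-member xs f m)

∑-positive : (xs : List X) (f : X → ℕ) → 1 ≤ ∑ xs f → ∃ λ x → x ∈ˡ xs × 1 ≤ f x
∑-positive (x ∷ xs) f h with f x in eq
... | suc m = x , here refl , subst (1 ≤_) (sym eq) (s≤s z≤n)
... | zero  with ∑-positive xs f h
...   | y , y∈ , q = y , there y∈ , q

-- Enumeration of finite types and decidable quantifiers.

vecs : List X → (l : ℕ) → List (Vec X l)
vecs xs zero    = [] ∷ []
vecs xs (suc l) = concatMap (λ x → map (x ∷_) (vecs xs l)) xs

∑-vecs-suc : (xs : List X) (l : ℕ) (f : Vec X (suc l) → ℕ) →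
             ∑ (vecs xs (suc l)) f ≡ ∑ xs (λ x → ∑ (vecs xs l) (λ v → f (x ∷ v)))
∑-vecs-suc xs l f =
  trans (∑-concatMap _ xs f) (∑-cong xs (λ x → ∑-map (x ∷_) (vecs xs l) f))

length-vecs : (xs : List X) (l : ℕ) → length (vecs xs l) ≡ length xs ^ l
length-vecs xs l = trans (length-∑ (vecs xs l)) (go l)
  where
  go : ∀ l → ∑ (vecs xs l) (λ _ → 1) ≡ length xs ^ l
  go zero    = refl
  go (suc l) = trans (∑-vecs-suc xs l _) (trans (∑-cong xs (λ _ → go l)) (∑-const xs _))

Complete : List X → Set
Complete xs = ∀ x → x ∈ˡ xs

vecs-complete : {xs : List X} → Complete xs → ∀ l → Complete (vecs xs l)
vecs-complete c zero    []      = here refl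
vecs-complete {xs = xs} c (suc l) (x ∷ v) =
  ∈-concatMap⁺ (λ x → map (x ∷_) (vecs xs l))
    (lose (c x) (∈-map⁺ (x ∷_) (vecs-complete c l v)))

abstract
  all-of? : {xs : List X} → Complete xs → {P : X → Set} → Decidable P → Dec (∀ x → P x)
  all-of? {xs = xs} c P? = map′ (λ a x → All.lookup a (c x)) (λ h → All.tabulate (λ {x} _ → h x)) (all? P? xs)

  any-of? : {xs : List X} → Complete xs → {P : X → Set} → Decidable P → Dec (∃ P)
  any-of? {xs = xs} c P? = map′ (λ a → proj₁ (find a) , proj₂ (proj₂ (find a))) (λ (x , p) → lose (c x) p) (any? P? xs)

bools : List Bool
bools = true ∷ false ∷ []

bools-complete : Complete bools
bools-complete true  = here refl
bools-complete false = there (here refl)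

length-allFin : ∀ n → length (allFin n) ≡ n
length-allFin n = length-tabulate (λ i → i)

∑-fin-suc : ∀ n (f : Fin (suc n) → ℕ) → ∑ (allFin (suc n)) f ≡ f zero + ∑ (allFin n) (f ∘ suc)
∑-fin-suc n f = cong (f zero +_) (trans (cong (λ l → ∑ l f) (sym (tab n suc))) (∑-map suc (allFin n) f))
  where
  tab : ∀ n (h : Fin n → Fin (suc n)) → map h (allFin n) ≡ tabulate h
  tab n h = map-tabulate (λ i → i) h

-- Uniqueness leaves at most one index equal to `b`. This is an inequality because `b` need not
-- occur in `xs`.
∑-pin : {A : Set} (_≟_ : DecidableEquality A) {xs : List A} → Unique xs → (g : A → ℕ) (b : A) →
        ∑ xs (λ v → g v * ind (v ≟ b)) ≤ g b
∑-pin _≟_ []            g b = z≤n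
∑-pin _≟_ {x ∷ xs} (x∉ ∷ u) g b with x ≟ b
... | yes refl = ≤-reflexive (trans (cong₂ _+_ (*-identityʳ (g x)) rest) (+-identityʳ (g x)))
  where
  rest : ∑ xs (λ v → g v * ind (v ≟ x)) ≡ 0
  rest = n≤0⇒n≡0 (≤-trans
    (∑-mono-∈ xs {g = λ _ → 0} λ {v} v∈ → ≤-reflexive
      (trans (cong (g v *_) (ind-no (v ≟ x) (λ e → All.lookup x∉ v∈ (sym e)))) (*-zeroʳ (g v))))
    (≤-reflexive (∑-zero xs)))
... | no _ = ≤-trans (≤-reflexive (cong (_+ ∑ xs (λ v → g v * ind (v ≟ b))) (*-zeroʳ (g x)))) (∑-pin _≟_ u g b)

subsets : (j : ℕ) → List (Subset j)
subsets = vecs bools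

subsets-complete : Complete (subsets j)
subsets-complete = vecs-complete bools-complete _

tuples : (n j : ℕ) → List (Vec (Fin n) j)
tuples n = vecs (allFin n)

tuples-complete : Complete (tuples n j)
tuples-complete = vecs-complete ∈-allFin _

-- Sums over fibres

fibreSum : Subset j → (Vec (Fin n) j → ℕ) → Vec (Fin n) j → ℕ
fibreSum []          g []       = g []
fibreSum {n = n} (true ∷ E)  g (x ∷ xs) = ∑ (allFin n) (λ v → fibreSum E (λ ys → g (v ∷ ys)) xs)
fibreSum (false ∷ E) g (x ∷ xs) = fibreSum E (λ ys → g (x ∷ ys)) xs

_≗_off_ : Vec (Fin n) j → Vec (Fin n) j → Subset j → Set
y ≗ x off E = ∀ i → lookup E i ≡ outside → lookup y i ≡ lookup x i

fibreSum-mono : (E : Subset j) {g h : Vec (Fin n) j → ℕ} (x : Vec (Fin n) j) →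
  (∀ y → y ≗ x off E → g y ≤ h y) → fibreSum E g x ≤ fibreSum E h x
fibreSum-mono []          []       le = le [] (λ ())
fibreSum-mono {n = n} (true ∷ E)  (x ∷ xs) le = ∑-mono (allFin n) λ v →
  fibreSum-mono E xs (λ ys a → le (v ∷ ys) λ { zero () ; (suc i) → a i })
fibreSum-mono (false ∷ E) (x ∷ xs) le =
  fibreSum-mono E xs (λ ys a → le (x ∷ ys) λ { zero _ → refl ; (suc i) → a i })

fibreSum-zero : (E : Subset j) (x : Vec (Fin n) j) → fibreSum E (λ _ → 0) x ≡ 0
fibreSum-zero []          []       = refl
fibreSum-zero {n = n} (true ∷ E)  (x ∷ xs) =
  trans (∑-cong (allFin n) (λ v → fibreSum-zero E xs)) (∑-zero (allFin n))
fibreSum-zero (false ∷ E) (x ∷ xs) = fibreSum-zero E xs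

fibreSum-const : (E : Subset j) (c : ℕ) (x : Vec (Fin n) j) → fibreSum E (λ _ → c) x ≡ n ^ ∣ E ∣ * c
fibreSum-const []          c []       = sym (+-identityʳ c)
fibreSum-const {n = n} (true ∷ E)  c (x ∷ xs) = trans (∑-cong (allFin n) (λ v → fibreSum-const E c xs))
  (trans (∑-const (allFin n) _) (trans (cong (_* (n ^ ∣ E ∣ * c)) (length-allFin n)) (sym (*-assoc n _ c))))
fibreSum-const (false ∷ E) c (x ∷ xs) = fibreSum-const E c xs

fibreSum-+ : (E : Subset j) (g h : Vec (Fin n) j → ℕ) (x : Vec (Fin n) j) →
  fibreSum E (λ y → g y + h y) x ≡ fibreSum E g x + fibreSum E h x
fibreSum-+ []          g h []       = refl
fibreSum-+ {n = n} (true ∷ E)  g h (x ∷ xs) =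
  trans (∑-cong (allFin n) (λ v → fibreSum-+ E _ _ xs)) (∑-+ (allFin n) _ _)
fibreSum-+ (false ∷ E) g h (x ∷ xs) = fibreSum-+ E _ _ xs

fibreSum-∑ : {A : Set} (as : List A) (E : Subset j) (g : A → Vec (Fin n) j → ℕ) (x : Vec (Fin n) j) →
  fibreSum E (λ y → ∑ as (λ a → g a y)) x ≡ ∑ as (λ a → fibreSum E (g a) x)
fibreSum-∑ []       E g x = fibreSum-zero E x
fibreSum-∑ (a ∷ as) E g x =
  trans (fibreSum-+ E (g a) _ x) (cong (fibreSum E (g a) x +_) (fibreSum-∑ as E g x))

fibreSum-*ʳ : (E : Subset j) (g : Vec (Fin n) j → ℕ) (c : ℕ) (x : Vec (Fin n) j) →
  fibreSum E (λ y → g y * c) x ≡ fibreSum E g x * c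
fibreSum-*ʳ []          g c []       = refl
fibreSum-*ʳ {n = n} (true ∷ E)  g c (x ∷ xs) =
  trans (∑-cong (allFin n) (λ v → fibreSum-*ʳ E _ c xs)) (∑-*ʳ (allFin n) c _)
fibreSum-*ʳ (false ∷ E) g c (x ∷ xs) = fibreSum-*ʳ E _ c xs

-- In the sum over coordinate `i` only the value `b` survives, so `i` leaves the free set and `b` is
-- written into the base point.
fibreSum-pin : (E : Subset j) (g : Vec (Fin n) j → ℕ) (x : Vec (Fin n) j) (i : Fin j) (b : Fin n) →
  lookup E i ≡ inside →
  fibreSum E (λ y → g y * ind (lookup y i Fin.≟ b)) x ≤ fibreSum (E [ i ]≔ outside) g (x [ i ]≔ b)
fibreSum-pin {n = n} (true ∷ E)  g (x ∷ xs) zero    b _ = ≤-trans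
  (≤-reflexive (∑-cong (allFin n) (λ v → fibreSum-*ʳ E (λ ys → g (v ∷ ys)) (ind (v Fin.≟ b)) xs)))
  (∑-pin Fin._≟_ (allFin⁺ n) (λ v → fibreSum E (λ ys → g (v ∷ ys)) xs) b)
fibreSum-pin {n = n} (true ∷ E)  g (x ∷ xs) (suc i) b i∈ =
  ∑-mono (allFin n) (λ v → fibreSum-pin E _ xs i b i∈)
fibreSum-pin (false ∷ E) g (x ∷ xs) (suc i) b i∈ = fibreSum-pin E _ xs i b i∈

-- Double counting: `y` lies in the fibre of `x` exactly when the two agree off `E`, and each `y`
-- has `n ^ ∣ E ∣` such base points.
∑-fibreSum : (E : Subset j) (g : Vec (Fin n) j → ℕ) →
  ∑ (tuples n j) (fibreSum E g) ≡ n ^ ∣ E ∣ * ∑ (tuples n j) g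
∑-fibreSum []          g = sym (+-identityʳ _)
∑-fibreSum {j = suc j} {n = n} (true ∷ E) g = begin
  ∑ (tuples n (suc j)) (fibreSum (true ∷ E) g)
    ≡⟨ ∑-vecs-suc (allFin n) j _ ⟩
  ∑ (allFin n) (λ _ → ∑ (tuples n j) (λ xs → ∑ (allFin n) (λ v → fibreSum E (λ ys → g (v ∷ ys)) xs)))
    ≡⟨ ∑-const (allFin n) _ ⟩
  length (allFin n) * ∑ (tuples n j) (λ xs → ∑ (allFin n) (λ v → fibreSum E (λ ys → g (v ∷ ys)) xs))
    ≡⟨ cong₂ _*_ (length-allFin n) (∑-swap (tuples n j) (allFin n) _) ⟩
  n * ∑ (allFin n) (λ v → ∑ (tuples n j) (fibreSum E (λ ys → g (v ∷ ys))))
    ≡⟨ cong (n *_) (∑-cong (allFin n) (λ v → ∑-fibreSum E (λ ys → g (v ∷ ys)))) ⟩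
  n * ∑ (allFin n) (λ v → n ^ ∣ E ∣ * ∑ (tuples n j) (λ ys → g (v ∷ ys)))
    ≡⟨ cong (n *_) (∑-*ˡ (allFin n) (n ^ ∣ E ∣) _) ⟩
  n * (n ^ ∣ E ∣ * ∑ (allFin n) (λ v → ∑ (tuples n j) (λ ys → g (v ∷ ys))))
    ≡⟨ sym (*-assoc n _ _) ⟩
  n * n ^ ∣ E ∣ * ∑ (allFin n) (λ v → ∑ (tuples n j) (λ ys → g (v ∷ ys)))
    ≡⟨ cong (n * n ^ ∣ E ∣ *_) (sym (∑-vecs-suc (allFin n) j g)) ⟩
  n * n ^ ∣ E ∣ * ∑ (tuples n (suc j)) g ∎
  where open ≡-Reasoning
∑-fibreSum {j = suc j} {n = n} (false ∷ E) g = begin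
  ∑ (tuples n (suc j)) (fibreSum (false ∷ E) g)
    ≡⟨ ∑-vecs-suc (allFin n) j _ ⟩
  ∑ (allFin n) (λ v → ∑ (tuples n j) (fibreSum E (λ ys → g (v ∷ ys))))
    ≡⟨ ∑-cong (allFin n) (λ v → ∑-fibreSum E (λ ys → g (v ∷ ys))) ⟩
  ∑ (allFin n) (λ v → n ^ ∣ E ∣ * ∑ (tuples n j) (λ ys → g (v ∷ ys)))
    ≡⟨ ∑-*ˡ (allFin n) (n ^ ∣ E ∣) _ ⟩
  n ^ ∣ E ∣ * ∑ (allFin n) (λ v → ∑ (tuples n j) (λ ys → g (v ∷ ys)))
    ≡⟨ cong (n ^ ∣ E ∣ *_) (sym (∑-vecs-suc (allFin n) j g)) ⟩
  n ^ ∣ E ∣ * ∑ (tuples n (suc j)) g ∎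
  where open ≡-Reasoning

-- Subsets of coordinates

_⊑_ : Subset j → Subset j → Set
V ⊑ E = ∀ i → lookup V i ≡ inside → lookup E i ≡ inside

_⊑?_ : (V E : Subset j) → Dec (V ⊑ E)
V ⊑? E = Fin.all? (λ i → (lookup V i Bool.≟ inside) →-dec (lookup E i Bool.≟ inside))

Inhabited : Subset j → Set
Inhabited V = ∃ λ i → lookup V i ≡ inside

inhabited? : (V : Subset j) → Dec (Inhabited V)
inhabited? V = Fin.any? (λ i → lookup V i Bool.≟ inside)

size-insert : (G : Subset j) (y : Fin j) → lookup G y ≡ outside → ∣ G [ y ]≔ inside ∣ ≡ suc ∣ G ∣
size-insert (false ∷ G) zero    _ = refl
size-insert (true ∷ G)  (suc y) p = cong suc (size-insert G y p)
size-insert (false ∷ G) (suc y) p = size-insert G y p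

size-delete : (E : Subset j) (i : Fin j) → lookup E i ≡ inside → ∣ E ∣ ≡ suc ∣ E [ i ]≔ outside ∣
size-delete (true ∷ E)  zero    _ = refl
size-delete (true ∷ E)  (suc i) p = cong suc (size-delete E i p)
size-delete (false ∷ E) (suc i) p = size-delete E i p

size-zero : (E : Subset j) → ∣ E ∣ ≡ 0 → ∀ i → lookup E i ≡ outside
size-zero (false ∷ E) p zero    = refl
size-zero (false ∷ E) p (suc i) = size-zero E p i

size-suc : (E : Subset j) {m : ℕ} → ∣ E ∣ ≡ suc m → Inhabited E
size-suc (true ∷ E)  _ = zero , refl
size-suc (false ∷ E) p = let i , q = size-suc E p in suc i , q

⊑-refl : {E : Subset j} → E ⊑ E
⊑-refl _ p = p

delete-⊑ : (E : Subset j) (i : Fin j) → (E [ i ]≔ outside) ⊑ E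
delete-⊑ E i l p with l Fin.≟ i
... | yes refl with () ← trans (sym p) (lookup∘update i E outside)
... | no l≢i   = trans (sym (lookup∘update′ l≢i E outside)) p

outside-complement : (G : Subset j) → ∑ (allFin j) (λ y → ind (lookup G y Bool.≟ outside)) + ∣ G ∣ ≡ j
outside-complement []          = refl
outside-complement {suc j} (true ∷ G)  = begin
  ∑ (allFin (suc j)) (λ y → ind (lookup (true ∷ G) y Bool.≟ outside)) + suc ∣ G ∣
    ≡⟨ cong (_+ suc ∣ G ∣) (∑-fin-suc j (λ y → ind (lookup (true ∷ G) y Bool.≟ outside))) ⟩
  ∑ (allFin j) (λ y → ind (lookup G y Bool.≟ outside)) + suc ∣ G ∣
    ≡⟨ +-suc _ _ ⟩
  suc (∑ (allFin j) (λ y → ind (lookup G y Bool.≟ outside)) + ∣ G ∣)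
    ≡⟨ cong suc (outside-complement G) ⟩
  suc j ∎
  where open ≡-Reasoning
outside-complement {suc j} (false ∷ G) =
  trans (cong (_+ ∣ G ∣) (∑-fin-suc j (λ y → ind (lookup (false ∷ G) y Bool.≟ outside)))) (cong suc (outside-complement G))

size-∑ : (U : Subset j) → ∑ (allFin j) (λ y → ind (lookup U y Bool.≟ inside)) ≡ ∣ U ∣
size-∑ []          = refl
size-∑ {suc j} (true ∷ U)  =
  trans (∑-fin-suc j (λ y → ind (lookup (true ∷ U) y Bool.≟ inside))) (cong suc (size-∑ U))
size-∑ {suc j} (false ∷ U) =
  trans (∑-fin-suc j (λ y → ind (lookup (false ∷ U) y Bool.≟ inside))) (size-∑ U)

powerset : Subset j → List (Subset j)
powerset []          = [] ∷ []
powerset (true ∷ G)  = map (true ∷_) (powerset G) ++ map (false ∷_) (powerset G)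
powerset (false ∷ G) = map (false ∷_) (powerset G)

length-powerset : (G : Subset j) → length (powerset G) ≡ 2 ^ ∣ G ∣
length-powerset []          = refl
length-powerset (true ∷ G)  = begin
  length (map (true ∷_) (powerset G) ++ map (false ∷_) (powerset G))
    ≡⟨ length-++ (map (true ∷_) (powerset G)) ⟩
  length (map (true ∷_) (powerset G)) + length (map (false ∷_) (powerset G))
    ≡⟨ cong₂ _+_ (trans (length-map _ (powerset G)) (length-powerset G))
                 (trans (trans (length-map _ (powerset G)) (length-powerset G)) (sym (+-identityʳ _))) ⟩
  2 ^ suc ∣ G ∣ ∎
  where open ≡-Reasoning
length-powerset (false ∷ G) = trans (length-map _ (powerset G)) (length-powerset G)

powerset-complete : (V G : Subset j) → V ⊑ G → V ∈ˡ powerset G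
powerset-complete []          []          _ = here refl
powerset-complete (true ∷ V)  (true ∷ G)  s = ∈-++⁺ˡ (∈-map⁺ _ (powerset-complete V G (s ∘ suc)))
powerset-complete (false ∷ V) (true ∷ G)  s =
  ∈-++⁺ʳ (map (true ∷_) (powerset G)) (∈-map⁺ _ (powerset-complete V G (s ∘ suc)))
powerset-complete (true ∷ V)  (false ∷ G) s with () ← s zero refl
powerset-complete (false ∷ V) (false ∷ G) s = ∈-map⁺ _ (powerset-complete V G (s ∘ suc))

powerset-size : (V G : Subset j) → V ∈ˡ powerset G → ∣ V ∣ ≤ ∣ G ∣
powerset-size V [] (here refl) = z≤n
powerset-size V (true ∷ G) m with ∈-++⁻ (map (true ∷_) (powerset G)) m
... | inj₁ q with ∈-map⁻ _ q
...   | W , W∈ , refl = s≤s (powerset-size W G W∈)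
powerset-size V (true ∷ G) m | inj₂ q with ∈-map⁻ _ q
...   | W , W∈ , refl = m≤n⇒m≤1+n (powerset-size W G W∈)
powerset-size V (false ∷ G) m with ∈-map⁻ _ m
... | W , W∈ , refl = powerset-size W G W∈

-- Movable coordinate sets

Fresh : Subset j → (B x y : Vec (Fin n) j) → Set
Fresh V B x y = (y ≗ x off V) × (∀ i → lookup V i ≡ inside → ∀ l → lookup y i ≢ lookup B l)

_≗?_off_ : (y x : Vec (Fin n) j) (E : Subset j) → Dec (y ≗ x off E)
y ≗? x off E = Fin.all? (λ i → (lookup E i Bool.≟ outside) →-dec (lookup y i Fin.≟ lookup x i))

fresh? : (V : Subset j) (B x y : Vec (Fin n) j) → Dec (Fresh V B x y)
fresh? V B x y = (y ≗? x off V) ×-dec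
  Fin.all? (λ i → (lookup V i Bool.≟ inside) →-dec Fin.all? (λ l → ¬? (lookup y i Fin.≟ lookup B l)))

-- B lists forbidden values: j of them suffice, as only the entries of another tuple must be avoided.
Movable : (Vec (Fin n) j → Set) → Subset j → Vec (Fin n) j → Set
Movable Φ V x = ∀ B → ∃ λ y → Φ y × Fresh V B x y

movable? : {Φ : Vec (Fin n) j → Set} → Decidable Φ → ∀ V → Decidable (Movable Φ V)
movable? Φ? V x = all-of? tuples-complete λ B → any-of? tuples-complete λ y → Φ? y ×-dec fresh? V B x y

Movable-mono : {Φ Ψ : Vec (Fin n) j → Set} → (∀ {x} → Φ x → Ψ x) → ∀ V {x} → Movable Φ V x → Movable Ψ V x
Movable-mono f V m B = let y , φ , fr = m B in y , f φ , fr

-- All quantifiers range over finite complete lists, so the negation can be turned into an explicit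
-- blocking tuple `B`.
unmovable : {Φ : Vec (Fin n) j → Set} → Decidable Φ → ∀ V x → ¬ Movable Φ V x →
            ∃ λ B → ∀ y → Φ y → ¬ Fresh V B x y
unmovable {Φ = Φ} Φ? V x ¬m with any-of? tuples-complete (λ B → ¬? (some? B))
  where
  some? : ∀ B → Dec (∃ λ y → Φ y × Fresh V B x y)
  some? B = any-of? tuples-complete λ y → Φ? y ×-dec fresh? V B x y
... | yes (B , none) = B , λ y φ fr → none (y , φ , fr)
... | no ¬∃          = ⊥-elim (¬m λ B → decidable-stable
        (any-of? tuples-complete λ y → Φ? y ×-dec fresh? V B x y) (λ none → ¬∃ (B , none)))

Bad : (Vec (Fin n) j → Set) → Subset j → Vec (Fin n) j → Set
Bad Φ E x = Φ x × (∀ V → V ⊑ E × Inhabited V → ¬ Movable Φ V x)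

bad? : {Φ : Vec (Fin n) j → Set} → Decidable Φ → ∀ E → Decidable (Bad Φ E)
bad? Φ? E x = Φ? x ×-dec
  all-of? subsets-complete (λ V → ((V ⊑? E) ×-dec inhabited? V) →-dec ¬? (movable? Φ? V x))

-- A blocking set for the coordinates E′ of one bad tuple must be hit by every bad tuple of its fibre;
-- pinning the coordinate where this happens decreases E′.
bad-fibre : {Φ : Vec (Fin n) j → Set} (Φ? : Decidable Φ) (E : Subset j) →
  ∀ m E′ → ∣ E′ ∣ ≡ m → E′ ⊑ E → ∀ x₀ →
  fibreSum E′ (λ x → ind (bad? Φ? E x)) x₀ ≤ (j * j) ^ m
bad-fibre {n = n} Φ? E zero E′ size _ x₀ = ≤-trans
  (fibreSum-mono E′ x₀ (λ y _ → ind≤1 (bad? Φ? E y)))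
  (≤-reflexive (trans (fibreSum-const E′ 1 x₀) (cong (λ e → n ^ e * 1) size)))
bad-fibre {n = n} {j = j} {Φ = Φ} Φ? E (suc m) E′ size E′⊑E x₀
  with any-of? tuples-complete (λ x → bad? Φ? E x ×-dec (x ≗? x₀ off E′))
... | no none = ≤-trans
        (fibreSum-mono E′ {h = λ _ → 0} x₀ (λ y a → ≤-reflexive (ind-no (bad? Φ? E y) (λ b → none (y , b , a)))))
        (≤-trans (≤-reflexive (fibreSum-zero E′ x₀)) z≤n)
... | yes (x , bad , agr) = begin
    fibreSum E′ g x₀
      ≤⟨ fibreSum-mono E′ x₀ hit ⟩
    fibreSum E′ (λ y → ∑ (allFin j) (λ i → ∑ (allFin j) (λ l → h i l y))) x₀
      ≡⟨ fibreSum-∑ (allFin j) E′ (λ i y → ∑ (allFin j) (λ l → h i l y)) x₀ ⟩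
    ∑ (allFin j) (λ i → fibreSum E′ (λ y → ∑ (allFin j) (λ l → h i l y)) x₀)
      ≡⟨ ∑-cong (allFin j) (λ i → fibreSum-∑ (allFin j) E′ (h i) x₀) ⟩
    ∑ (allFin j) (λ i → ∑ (allFin j) (λ l → fibreSum E′ (h i l) x₀))
      ≤⟨ ∑-≤-const (allFin j) _ (λ {i} _ → ∑-≤-const (allFin j) _ (λ {l} _ → pinned i l)) ⟩
    length (allFin j) * (length (allFin j) * (j * j) ^ m)
      ≡⟨ cong₂ (λ a b → a * (b * (j * j) ^ m)) (length-allFin j) (length-allFin j) ⟩
    j * (j * (j * j) ^ m)
      ≡⟨ sym (*-assoc j j _) ⟩
    (j * j) ^ suc m ∎
  where
  open ≤-Reasoning
  g : Vec (Fin n) j → ℕ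
  g y = ind (bad? Φ? E y)
  blocked : ∃ λ B → ∀ y → Φ y → ¬ Fresh E′ B x y
  blocked = unmovable Φ? E′ x (proj₂ bad E′ (E′⊑E , size-suc E′ size))
  B : Vec (Fin n) j
  B = proj₁ blocked
  -- The pair `(i , l)` records that entry `i` of `y` meets the blocking entry `l`. There are
  -- `j * j` pairs, which gives the base of the bound; the first factor discards `i` outside `E′`.
  h : Fin j → Fin j → Vec (Fin n) j → ℕ
  h i l y = ind (lookup E′ i Bool.≟ inside) * (g y * ind (lookup y i Fin.≟ lookup B l))
  hit : ∀ y → y ≗ x₀ off E′ → g y ≤ ∑ (allFin j) (λ i → ∑ (allFin j) (λ l → h i l y))
  hit y ya = ind-≤ (bad? Φ? E y) λ b →
    let
      i , i∈ , l , eq = find-hit b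
    in ∑-member-pos (allFin j) _ (∈-allFin i) (∑-member-pos (allFin j) _ (∈-allFin l) (≤-reflexive (sym
        (cong₂ _*_ (ind-yes (lookup E′ i Bool.≟ inside) i∈)
          (cong₂ _*_ (ind-yes (bad? Φ? E y) b) (ind-yes (lookup y i Fin.≟ lookup B l) eq))))))
    where
    find-hit : Bad Φ E y → ∃ λ i → lookup E′ i ≡ inside × ∃ λ l → lookup y i ≡ lookup B l
    find-hit b = decidable-stable
      (Fin.any? λ i → (lookup E′ i Bool.≟ inside) ×-dec Fin.any? λ l → lookup y i Fin.≟ lookup B l)
      (λ none → proj₂ blocked y (proj₁ b)
        ((λ i o → trans (ya i o) (sym (agr i o))) , λ i i∈ l eq → none (i , i∈ , l , eq)))
  pinned : ∀ i l → fibreSum E′ (h i l) x₀ ≤ (j * j) ^ m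
  pinned i l with lookup E′ i Bool.≟ inside
  ... | no _   = ≤-trans (≤-reflexive (fibreSum-zero E′ x₀)) z≤n
  ... | yes i∈ = ≤-trans
    (fibreSum-mono E′ {h = λ y → g y * ind (lookup y i Fin.≟ lookup B l)} x₀ (λ y _ → ≤-reflexive (*-identityˡ _)))
    (≤-trans (fibreSum-pin E′ g x₀ i (lookup B l) i∈)
      (bad-fibre Φ? E m (E′ [ i ]≔ outside) (suc-injective (trans (sym (size-delete E′ i i∈)) size))
        (λ i′ → E′⊑E i′ ∘ delete-⊑ E′ i i′) (x₀ [ i ]≔ lookup B l)))

-- Averaging over fibres: each of the `n ^ j` fibre sums is bounded by `bad-fibre`, and each bad
-- tuple is counted in `n ^ ∣ E ∣` of them. So a random tuple is bad with probability of order
-- `n ^ (- ∣ E ∣)`.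
bad-count : {Φ : Vec (Fin n) j → Set} (Φ? : Decidable Φ) (E : Subset j) →
  n ^ ∣ E ∣ * ∑ (tuples n j) (λ x → ind (bad? Φ? E x)) ≤ (j * j) ^ ∣ E ∣ * n ^ j
bad-count {n = n} {j = j} Φ? E = begin
  n ^ ∣ E ∣ * ∑ (tuples n j) (λ x → ind (bad? Φ? E x))
    ≡⟨ sym (∑-fibreSum E _) ⟩
  ∑ (tuples n j) (fibreSum E (λ x → ind (bad? Φ? E x)))
    ≤⟨ ∑-≤-const (tuples n j) _ (λ {x} _ → bad-fibre Φ? E ∣ E ∣ E refl (⊑-refl {E = E}) x) ⟩
  length (tuples n j) * (j * j) ^ ∣ E ∣
    ≡⟨ cong (_* (j * j) ^ ∣ E ∣) (trans (length-vecs (allFin n) j) (cong (_^ j) (length-allFin n))) ⟩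
  n ^ j * (j * j) ^ ∣ E ∣
    ≡⟨ *-comm (n ^ j) _ ⟩
  (j * j) ^ ∣ E ∣ * n ^ j ∎
  where open ≤-Reasoning

-- Extensions of a fixed set of coordinates

module _ {Mov : Subset j → Set} (Mov? : Decidable Mov) where

  NonFree : Subset j → Set
  NonFree G = ∃ λ V → (V ⊑ G × Inhabited V) × Mov V

  nonFree? : Decidable NonFree
  nonFree? G = any-of? subsets-complete (λ V → ((V ⊑? G) ×-dec inhabited? V) ×-dec Mov? V)

  Extends : Subset j → Fin j → Set
  Extends G y = lookup G y ≡ outside × Mov (G [ y ]≔ inside)

  extends? : ∀ G → Decidable (Extends G)
  extends? G y = (lookup G y Bool.≟ outside) ×-dec Mov? (G [ y ]≔ inside)

  extensions : Subset j → ℕ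
  extensions G = ∑ (allFin j) (λ y → ind (extends? G y))

  -- A movable set inside `G ∪ {y}` must contain `y`, since `G` is free; deleting `y` from it leaves
  -- the required `G₀`.
  split-movable : ∀ G y → lookup G y ≡ outside → ¬ NonFree G → NonFree (G [ y ]≔ inside) →
                  ∃ λ G₀ → G₀ ∈ˡ powerset G × Extends G₀ y
  split-movable G y y∉G free (V , (V⊑ , inh) , mov) =
    V [ y ]≔ outside , powerset-complete _ G below , lookup∘update y V outside , subst Mov (sym restore) mov
    where
    y∈V : lookup V y ≡ inside
    y∈V = decidable-stable (lookup V y Bool.≟ inside) λ y∉V → free (V , (V⊑G y∉V , inh) , mov)
      where
      V⊑G : lookup V y ≢ inside → V ⊑ G
      V⊑G y∉V i i∈ with i Fin.≟ y
      ... | yes refl = ⊥-elim (y∉V i∈)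
      ... | no i≢y   = trans (sym (lookup∘update′ i≢y G inside)) (V⊑ i i∈)
    below : (V [ y ]≔ outside) ⊑ G
    below i i∈ with i Fin.≟ y
    ... | yes refl with () ← trans (sym i∈) (lookup∘update y V outside)
    ... | no i≢y = trans (sym (lookup∘update′ i≢y G inside)) (V⊑ i (delete-⊑ V y i i∈))
    restore : (V [ y ]≔ outside) [ y ]≔ inside ≡ V
    restore = trans ([]≔-idempotent V y) (trans (cong (V [ y ]≔_) (sym y∈V)) ([]≔-lookup V y))

  -- G is grown to a maximal free set; each y outside it then extends some subset of G.
  popular-subset : (k : ℕ) → k + 2 ^ k * k ≤ j → (∀ E → ∣ E ∣ ≡ k → NonFree E) →
    ∃ λ G → ∣ G ∣ < k × k ≤ extensions G
  popular-subset k k≤j good = grow k ⊥ (cong (_+ k) (∣⊥∣≡0 j)) free-⊥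
    where
    free-⊥ : ¬ NonFree ⊥
    free-⊥ (V , (V⊑ , i , i∈) , _) with () ← trans (sym (V⊑ i i∈)) (size-zero ⊥ (∣⊥∣≡0 j) i)
    Result : Set
    Result = ∃ λ G → ∣ G ∣ < k × k ≤ extensions G
    grow : ∀ f G → ∣ G ∣ + f ≡ k → ¬ NonFree G → Result
    -- `f` counts the coordinates still to be added. At size `k` the set cannot be free, by `good`.
    grow zero    G size free = ⊥-elim (free (good G (trans (sym (+-identityʳ _)) size)))
    grow (suc f) G size free
      with Fin.any? (λ y → (lookup G y Bool.≟ outside) ×-dec ¬? (nonFree? (G [ y ]≔ inside)))
    ... | yes (y , y∉ , free′) = grow f (G [ y ]≔ inside)
          (trans (cong (_+ f) (size-insert G y y∉)) (trans (sym (+-suc ∣ G ∣ f)) size)) free′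
    ... | no maximal with any-of? subsets-complete (λ H → (∣ H ∣ <? k) ×-dec (k ≤? extensions H))
    ...   | yes r    = r
    -- Pigeonhole: each coordinate outside `G` extends one of the `2 ^ ∣ G ∣` subsets of `G`, and
    -- each of these has at most `k` extensions, so `j` would be below `k + 2 ^ k * k`.
    ...   | no scarce = ⊥-elim (<⇒≱ (begin-strict
            j
              ≡⟨ sym (outside-complement G) ⟩
            ∑ (allFin j) (λ y → ind (lookup G y Bool.≟ outside)) + ∣ G ∣
              ≤⟨ +-monoˡ-≤ ∣ G ∣ (∑-mono (allFin j) covered) ⟩
            ∑ (allFin j) (λ y → ∑ (powerset G) (λ G₀ → ind (extends? G₀ y))) + ∣ G ∣
              ≡⟨ cong (_+ ∣ G ∣) (∑-swap (allFin j) (powerset G) _) ⟩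
            ∑ (powerset G) extensions + ∣ G ∣
              ≤⟨ +-monoˡ-≤ ∣ G ∣ (∑-≤-const (powerset G) k few) ⟩
            length (powerset G) * k + ∣ G ∣
              ≡⟨ cong (λ p → p * k + ∣ G ∣) (length-powerset G) ⟩
            2 ^ ∣ G ∣ * k + ∣ G ∣
              <⟨ +-mono-≤-< (*-monoˡ-≤ k (^-monoʳ-≤ 2 (<⇒≤ G<k))) G<k ⟩
            2 ^ k * k + k
              ≡⟨ +-comm (2 ^ k * k) k ⟩
            k + 2 ^ k * k ∎) k≤j)
      where
      open ≤-Reasoning
      G<k : ∣ G ∣ < k
      G<k = subst (∣ G ∣ <_) size (m<m+n ∣ G ∣ (s≤s z≤n))
      covered : ∀ y → ind (lookup G y Bool.≟ outside) ≤ ∑ (powerset G) (λ G₀ → ind (extends? G₀ y))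
      covered y = ind-≤ (lookup G y Bool.≟ outside) λ y∉ →
        let G₀ , G₀∈ , ext = split-movable G y y∉ free
              (decidable-stable (nonFree? (G [ y ]≔ inside)) (λ fr → maximal (y , y∉ , fr)))
        in ∑-member-pos (powerset G) _ G₀∈ (≤-reflexive (sym (ind-yes (extends? G₀ y) ext)))
      few : ∀ {H} → H ∈ˡ powerset G → extensions H ≤ k
      few {H} H∈ = ≰⇒≥ λ k≤ → scarce (H , ≤-<-trans (powerset-size H G H∈) G<k , k≤)

-- Walks of moves sharing a common set G.

_≟ˢ_ : DecidableEquality (Subset j)
_≟ˢ_ = ≡-dec Bool._≟_

extensions-mono : {Mov Mov′ : Subset j → Set} (Mov? : Decidable Mov) (Mov′? : Decidable Mov′) →
  (∀ V → Mov V → Mov′ V) → ∀ G → extensions Mov? G ≤ extensions Mov′? G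
extensions-mono {j = j} Mov? Mov′? f G = ∑-mono (allFin j) λ y →
  ind-mono (extends? Mov? G y) (extends? Mov′? G y) (λ (o , m) → o , f _ m)

new-extension : {Mov : Subset j → Set} (Mov? : Decidable Mov) → ∀ G U → ∣ U ∣ < extensions Mov? G →
  ∃ λ y → lookup U y ≡ outside × Extends Mov? G y
new-extension {j = j} Mov? G U lt = decidable-stable
  (Fin.any? λ y → (lookup U y Bool.≟ outside) ×-dec extends? Mov? G y)
  (λ none → <⇒≱ lt (≤-trans
    (∑-mono (allFin j) (λ y → ind-mono (extends? Mov? G y) (lookup U y Bool.≟ inside)
      (λ ext → decidable-stable (lookup U y Bool.≟ inside) (λ o → none (y , Bool.¬-not o , ext)))))
    (≤-reflexive (size-∑ U))))

update-outside : (U : Subset j) (y i : Fin j) → lookup (U [ y ]≔ inside) i ≡ outside → i ≢ y × lookup U i ≡ outside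
update-outside U y i o with i Fin.≟ y
... | yes refl with () ← trans (sym o) (lookup∘update y U inside)
... | no i≢y = i≢y , trans (sym (lookup∘update′ i≢y U inside)) o

not-inside : {a b : Bool} → (a ≡ inside → b ≡ inside) → b ≡ outside → a ≡ outside
not-inside {false} f o = refl
not-inside {true}  f o with () ← trans (sym (f refl)) o

insert-⊒ : (U : Subset j) (y : Fin j) → U ⊑ (U [ y ]≔ inside)
insert-⊒ U y i i∈ with i Fin.≟ y
... | yes refl = lookup∘update y U inside
... | no i≢y   = trans (lookup∘update′ i≢y U inside) i∈

-- Two moves compose: the second one rewrites only `G` and `y`, with values avoiding `B`, and leaves
-- the entries on the rest of `U`, which avoid `B` already. Since `G ⊑ U`, no coordinate outside `U`
-- and `y` changes.
Fresh-trans : (G U : Subset j) (y : Fin j) → G ⊑ U → (B x₀ x x′ : Vec (Fin n) j) →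
  Fresh U B x₀ x → Fresh (G [ y ]≔ inside) B x x′ → Fresh (U [ y ]≔ inside) B x₀ x′
Fresh-trans G U y G⊑U B x₀ x x′ (off , new) (off′ , new′) = off″ , new″
  where
  off″ : x′ ≗ x₀ off (U [ y ]≔ inside)
  off″ i o with update-outside U y i o
  ... | i≢y , o′ = trans (off′ i (trans (lookup∘update′ i≢y G inside) (not-inside (G⊑U i) o′))) (off i o′)
  new″ : ∀ i → lookup (U [ y ]≔ inside) i ≡ inside → ∀ l → lookup x′ i ≢ lookup B l
  new″ i i∈ l with lookup (G [ y ]≔ inside) i in eq
  ... | true  = new′ i eq l
  ... | false with update-outside G y i eq
  ...   | i≢y , _ = λ e → new i (trans (sym (lookup∘update′ i≢y U inside)) i∈) l (trans (sym (off′ i eq)) e)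

module _ (k : ℕ) {Φ : Vec (Fin n) j → Set} (Φ? : Decidable Φ) where

  -- From x one can make w moves inside Φ, each along G plus one further
  -- coordinate, with at least k choices for that coordinate at every step.
  Walks : ℕ → Subset j → Vec (Fin n) j → Set
  walks? : ∀ w G → Decidable (Walks w G)
  Walks zero    G x = Φ x
  Walks (suc w) G x = Φ x × k ≤ extensions (λ V → movable? (walks? w G) V x) G
  walks? zero    G x = Φ? x
  walks? (suc w) G x = Φ? x ×-dec (k ≤? extensions (λ V → movable? (walks? w G) V x) G)

  Walks⇒Φ : ∀ w G {x} → Walks w G x → Φ x
  Walks⇒Φ zero    G φ = φ
  Walks⇒Φ (suc w) G φ = proj₁ φ

  walk-step : ∀ G w x U → Walks (suc w) G x → ∣ U ∣ < k →
    ∃ λ y → lookup U y ≡ outside × lookup G y ≡ outside × Movable (Walks w G) (G [ y ]≔ inside) x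
  walk-step G w x U (_ , many) U<k = new-extension (λ V → movable? (walks? w G) V x) G U (<-≤-trans U<k many)

  -- Here `x₀` serves as base point and as list of forbidden values: if the entries of `y` are
  -- distinct, then exactly `k` of them do not occur in `x₀`.
  Reaches : Vec (Fin n) j → Set
  Reaches x₀ = ∃ λ y → ∃ λ V → Φ y × ∣ V ∣ ≡ k × Fresh V x₀ x₀ y

  -- `U` is the set of coordinates changed since `x₀`. While it has fewer than `k` elements, the `k`
  -- choices at each step include a coordinate outside `U`, so its size grows by exactly one until
  -- it equals `k`.
  walk : ∀ G x₀ w x U → Walks w G x → Fresh U x₀ x₀ x → G ⊑ U → ∣ U ∣ ≤ k → k ≤ ∣ U ∣ + w → Reaches x₀
  walk G x₀ w x U ws fr G⊑U U≤k k≤ with ∣ U ∣ ≟ k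
  ... | yes e = x , U , Walks⇒Φ w G ws , e , fr
  walk G x₀ zero x U ws fr G⊑U U≤k k≤ | no ne =
    ⊥-elim (ne (≤-antisym U≤k (subst (k ≤_) (+-identityʳ _) k≤)))
  walk G x₀ (suc w) x U ws fr G⊑U U≤k k≤ | no ne =
    let y , y∉U , _ , mov = walk-step G w x U ws (≤∧≢⇒< U≤k ne)
        x′ , ws′ , fr′ = mov x₀
        size = size-insert U y y∉U
    in walk G x₀ w x′ (U [ y ]≔ inside) ws′ (Fresh-trans G U y G⊑U x₀ x₀ x x′ fr fr′)
         (λ i → insert-⊒ U y i ∘ G⊑U i)
         (≤-trans (≤-reflexive size) (≤∧≢⇒< U≤k ne))
         (≤-trans k≤ (≤-reflexive (trans (+-suc ∣ U ∣ w) (cong (_+ w) (sym size)))))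

  -- The first move is made separately, because `walk` needs all of `G` to have been changed
  -- already. It yields `∣ U ∣ = ∣ G ∣ + 1`, which is at most `k`.
  long-walk : ∀ G x₀ w → ∣ G ∣ < k → k ≤ w → Walks w G x₀ → Reaches x₀
  long-walk G x₀ zero    G<k k≤w ws = ⊥-elim (n≮0 (≤-trans G<k k≤w))
  long-walk G x₀ (suc w) G<k k≤w ws =
    let y , y∉G , _ , mov = walk-step G w x₀ G ws G<k
        x′ , ws′ , fr′ = mov x₀
        size = size-insert G y y∉G
    in walk G x₀ w x′ (G [ y ]≔ inside) ws′ fr′ (insert-⊒ G y)
         (≤-trans (≤-reflexive size) G<k)
         (≤-trans k≤w (≤-trans (s≤s (m≤n+m w ∣ G ∣)) (≤-reflexive (cong (_+ w) (sym size)))))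

-- Counting tuples by induction on a potential.

bump : (Subset j → ℕ) → Subset j → Subset j → ℕ
bump w G H with H ≟ˢ G
... | yes _ = suc (w H)
... | no _  = w H

bump-≥ : (w : Subset j → ℕ) (G H : Subset j) → w H ≤ bump w G H
bump-≥ w G H with H ≟ˢ G
... | yes _ = n≤1+n _
... | no _  = ≤-refl

bump-self : (w : Subset j → ℕ) (G : Subset j) → bump w G G ≡ suc (w G)
bump-self w G with G ≟ˢ G
... | yes _ = refl
... | no ne = ⊥-elim (ne refl)

-- This solves the recursion of `count-step`: the first summand pays for the bad tuples of the at
-- most `2 ^ j` sets `E`, the second for the popular tuples of the `2 ^ j` sets `G`.
tupleConstant : (k j fuel : ℕ) → ℕ
tupleConstant k j zero    = 2 ^ j * (j * j) ^ k
tupleConstant k j (suc f) = 2 ^ j * (j * j) ^ k + 2 ^ j * tupleConstant k j f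

length-subsets : ∀ j → length (subsets j) ≡ 2 ^ j
length-subsets = length-vecs bools

module _ (k : ℕ) (k≤j : k + 2 ^ k * k ≤ j) {Φ : Vec (Fin n) j → Set} (Φ? : Decidable Φ)
         (avoids : ∀ {x} → Φ x → ¬ Reaches k Φ? x) where

  private
    Popular : {Ψ : Vec (Fin n) j → Set} → Decidable Ψ → Subset j → Vec (Fin n) j → Set
    Popular {Ψ} Ψ? G x = Ψ x × (∣ G ∣ < k × k ≤ extensions (λ V → movable? Ψ? V x) G)

    popular? : {Ψ : Vec (Fin n) j → Set} (Ψ? : Decidable Ψ) → ∀ G → Decidable (Popular Ψ? G)
    popular? Ψ? G x = Ψ? x ×-dec ((∣ G ∣ <? k) ×-dec (k ≤? extensions (λ V → movable? Ψ? V x) G))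

    kBad? : {Ψ : Vec (Fin n) j → Set} (Ψ? : Decidable Ψ) → ∀ E → Decidable (λ x → ∣ E ∣ ≡ k × Bad Ψ E x)
    kBad? Ψ? E x = (∣ E ∣ ≟ k) ×-dec bad? Ψ? E x

    kBad-count : {Ψ : Vec (Fin n) j → Set} (Ψ? : Decidable Ψ) → ∀ E →
      n ^ k * ∑ (tuples n j) (λ x → ind (kBad? Ψ? E x)) ≤ (j * j) ^ k * n ^ j
    kBad-count Ψ? E with ∣ E ∣ ≟ k
    ... | yes refl = ≤-trans
          (*-monoʳ-≤ (n ^ ∣ E ∣) (∑-mono (tuples n j)
            (λ x → ind-mono (yes refl ×-dec bad? Ψ? E x) (bad? Ψ? E x) proj₂)))
          (bad-count Ψ? E)
    ... | no ne = ≤-trans (≤-reflexive (trans (cong (n ^ k *_)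
            (trans (∑-cong (tuples n j) (λ x → ind-no (no ne ×-dec bad? Ψ? E x) (ne ∘ proj₁))) (∑-zero (tuples n j))))
            (*-zeroʳ (n ^ k)))) z≤n

    -- If `x` is bad for no `E` of size `k`, every such `E` contains a movable set, and
    -- `popular-subset` supplies a `G`.
    dichotomy : {Ψ : Vec (Fin n) j → Set} (Ψ? : Decidable Ψ) → ∀ x →
      ind (Ψ? x) ≤ ∑ (subsets j) (λ E → ind (kBad? Ψ? E x)) + ∑ (subsets j) (λ G → ind (popular? Ψ? G x))
    dichotomy {Ψ} Ψ? x = ind-≤ (Ψ? x) bound
      where
      bound : Ψ x → 1 ≤ ∑ (subsets j) (λ E → ind (kBad? Ψ? E x)) + ∑ (subsets j) (λ G → ind (popular? Ψ? G x))
      bound ψ with any-of? subsets-complete (λ E → kBad? Ψ? E x)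
      ... | yes (E , bad) = ≤-trans
            (∑-member-pos (subsets j) _ (subsets-complete E) (≤-reflexive (sym (ind-yes (kBad? Ψ? E x) bad))))
            (m≤m+n _ _)
      ... | no good with popular-subset (λ V → movable? Ψ? V x) k k≤j
              (λ E size → decidable-stable (nonFree? (λ V → movable? Ψ? V x) E)
                (λ free → good (E , size , ψ , λ V sub mov → free (V , sub , mov))))
      ...   | G , pop = ≤-trans
            (∑-member-pos (subsets j) _ (subsets-complete G) (≤-reflexive (sym (ind-yes (popular? Ψ? G x) (ψ , pop)))))
            (m≤n+m _ _)

    -- Invariant: for each `G`, every tuple of `Ψ` starts a walk of length `w G` inside `Φ`.
    -- Restricting `Ψ` to the tuples popular for `G` raises `w G` by one, so the potential, the sum
    -- of `k ∸ w G`, falls and bounds the depth of the recursion.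
    count-bound : ∀ fuel (w : Subset j → ℕ) {Ψ : Vec (Fin n) j → Set} (Ψ? : Decidable Ψ) →
      ∑ (subsets j) (λ G → k ∸ w G) ≤ fuel → (∀ G {x} → Ψ x → Walks k Φ? (w G) G x) →
      n ^ k * ∑ (tuples n j) (λ x → ind (Ψ? x)) ≤ tupleConstant k j fuel * n ^ j

    popular-count : ∀ fuel (w : Subset j → ℕ) {Ψ : Vec (Fin n) j → Set} (Ψ? : Decidable Ψ) →
      ∑ (subsets j) (λ G → k ∸ w G) ≤ fuel → (∀ G {x} → Ψ x → Walks k Φ? (w G) G x) →
      (c : ℕ) → (∀ f → fuel ≡ suc f → tupleConstant k j f ≤ c) → ∀ G →
      n ^ k * ∑ (tuples n j) (λ x → ind (popular? Ψ? G x)) ≤ c * n ^ j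
    popular-count fuel w {Ψ} Ψ? pot inv c hc G with k ≤? w G
    -- No tuple is popular here: it would start a walk of length at least `k`, whose end contradicts
    -- `avoids`.
    ... | yes k≤w = ≤-trans (≤-reflexive (trans (cong (n ^ k *_)
            (trans (∑-cong (tuples n j) (λ x → ind-no (popular? Ψ? G x) (λ (ψ , G<k , _) →
                avoids (Walks⇒Φ k Φ? (w G) G (inv G ψ)) (long-walk k Φ? G x (w G) G<k k≤w (inv G ψ)))))
              (∑-zero (tuples n j))))
            (*-zeroʳ (n ^ k)))) z≤n
    ... | no k≰w = go fuel pot hc
      where
      dec : ∑ (subsets j) (λ H → k ∸ bump w G H) < ∑ (subsets j) (λ H → k ∸ w H)
      dec = ∑-mono-< (subsets j) (λ H → ∸-monoʳ-≤ k (bump-≥ w G H)) (subsets-complete G)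
              (subst (λ b → k ∸ b < k ∸ w G) (sym (bump-self w G)) (∸-monoʳ-< ≤-refl (≰⇒> k≰w)))
      inv′ : ∀ H {x} → Popular Ψ? G x → Walks k Φ? (bump w G H) H x
      inv′ H {x} (ψ , _ , many) with H ≟ˢ G
      ... | no _     = inv H ψ
      -- The `k` extensions are movable inside `Ψ`, and by `inv` every tuple of `Ψ` continues with
      -- `w G` more moves.
      ... | yes refl = Walks⇒Φ k Φ? (w G) G (inv G ψ) , ≤-trans many
            (extensions-mono (λ V → movable? Ψ? V x) (λ V → movable? (walks? k Φ? (w G) G) V x)
              (λ V → Movable-mono (inv G) V {x}) G)
      go : ∀ fuel → ∑ (subsets j) (λ H → k ∸ w H) ≤ fuel → (∀ f → fuel ≡ suc f → tupleConstant k j f ≤ c) →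
        n ^ k * ∑ (tuples n j) (λ x → ind (popular? Ψ? G x)) ≤ c * n ^ j
      go zero    p _ with () ← ≤-trans dec p
      go (suc f) p h = ≤-trans (count-bound f (bump w G) (popular? Ψ? G) (s≤s⁻¹ (≤-trans dec p)) inv′)
                         (*-monoˡ-≤ (n ^ j) (h f refl))

    count-step : ∀ c {Ψ : Vec (Fin n) j → Set} (Ψ? : Decidable Ψ) →
      (∀ G → n ^ k * ∑ (tuples n j) (λ x → ind (popular? Ψ? G x)) ≤ c * n ^ j) →
      n ^ k * ∑ (tuples n j) (λ x → ind (Ψ? x)) ≤ (2 ^ j * (j * j) ^ k + 2 ^ j * c) * n ^ j
    count-step c Ψ? pop = begin
      n ^ k * ∑ (tuples n j) (λ x → ind (Ψ? x))
        ≤⟨ *-monoʳ-≤ (n ^ k) (∑-mono (tuples n j) (dichotomy Ψ?)) ⟩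
      n ^ k * ∑ (tuples n j) (λ x → ∑ (subsets j) (λ E → ind (kBad? Ψ? E x)) + ∑ (subsets j) (λ G → ind (popular? Ψ? G x)))
        ≡⟨ cong (n ^ k *_) (∑-+ (tuples n j) _ _) ⟩
      n ^ k * (∑ (tuples n j) (λ x → ∑ (subsets j) (λ E → ind (kBad? Ψ? E x)))
               + ∑ (tuples n j) (λ x → ∑ (subsets j) (λ G → ind (popular? Ψ? G x))))
        ≡⟨ *-distribˡ-+ (n ^ k) _ _ ⟩
      n ^ k * ∑ (tuples n j) (λ x → ∑ (subsets j) (λ E → ind (kBad? Ψ? E x)))
        + n ^ k * ∑ (tuples n j) (λ x → ∑ (subsets j) (λ G → ind (popular? Ψ? G x)))
        ≤⟨ +-mono-≤ (over-subsets (λ E x → ind (kBad? Ψ? E x)) ((j * j) ^ k) (kBad-count Ψ?))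
                    (over-subsets (λ G x → ind (popular? Ψ? G x)) c pop) ⟩
      2 ^ j * (j * j) ^ k * n ^ j + 2 ^ j * c * n ^ j
        ≡⟨ sym (*-distribʳ-+ (n ^ j) (2 ^ j * (j * j) ^ k) (2 ^ j * c)) ⟩
      (2 ^ j * (j * j) ^ k + 2 ^ j * c) * n ^ j ∎
      where
      open ≤-Reasoning
      over-subsets : (g : Subset j → Vec (Fin n) j → ℕ) (a : ℕ) →
        (∀ E → n ^ k * ∑ (tuples n j) (g E) ≤ a * n ^ j) →
        n ^ k * ∑ (tuples n j) (λ x → ∑ (subsets j) (λ E → g E x)) ≤ 2 ^ j * a * n ^ j
      over-subsets g a h = begin
        n ^ k * ∑ (tuples n j) (λ x → ∑ (subsets j) (λ E → g E x))
          ≡⟨ cong (n ^ k *_) (∑-swap (tuples n j) (subsets j) _) ⟩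
        n ^ k * ∑ (subsets j) (λ E → ∑ (tuples n j) (g E))
          ≡⟨ sym (∑-*ˡ (subsets j) (n ^ k) _) ⟩
        ∑ (subsets j) (λ E → n ^ k * ∑ (tuples n j) (g E))
          ≤⟨ ∑-≤-const (subsets j) _ (λ {E} _ → h E) ⟩
        length (subsets j) * (a * n ^ j)
          ≡⟨ cong (_* (a * n ^ j)) (length-subsets j) ⟩
        2 ^ j * (a * n ^ j)
          ≡⟨ sym (*-assoc (2 ^ j) a _) ⟩
        2 ^ j * a * n ^ j ∎

    -- With zero potential every `w G` is at least `k`, so nothing is popular and the constant 0
    -- suffices.
    count-bound zero    w Ψ? pot inv = ≤-trans
      (count-step 0 Ψ? (popular-count zero w Ψ? pot inv 0 (λ _ ())))
      (≤-reflexive (cong (_* n ^ j) (trans (cong (2 ^ j * (j * j) ^ k +_) (*-zeroʳ (2 ^ j))) (+-identityʳ _))))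
    count-bound (suc f) w Ψ? pot inv =
      count-step (tupleConstant k j f) Ψ? (popular-count (suc f) w Ψ? pot inv _ (λ { _ refl → ≤-refl }))

  -- The induction starts from walks of length 0, where the invariant is `Φ` itself and each of the
  -- `2 ^ j` sets contributes `k` to the potential.
  tuple-bound : n ^ k * ∑ (tuples n j) (λ x → ind (Φ? x)) ≤ tupleConstant k j (2 ^ j * k) * n ^ j
  tuple-bound = count-bound (2 ^ j * k) (λ _ → 0) Φ?
    (≤-reflexive (trans (∑-const (subsets j) k) (cong (_* k) (length-subsets j)))) (λ _ φ → φ)

-- Words and their underlying sets

set : List (Fin n) → Subset n
set []      = ⊥
set (x ∷ w) = ⁅ x ⁆ ∪ set w

set-++ : (u v : List (Fin n)) → set (u ++ v) ≡ set u ∪ set v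
set-++ []      v = sym (∪-identityˡ (set v))
set-++ (x ∷ u) v = trans (cong (⁅ x ⁆ ∪_) (set-++ u v)) (sym (∪-assoc ⁅ x ⁆ (set u) (set v)))

∪-insert : (B : Subset n) (x : Fin n) → x ∉ B → ∣ B ∪ ⁅ x ⁆ ∣ ≡ suc ∣ B ∣
∪-insert (true ∷ B)  zero    x∉ = ⊥-elim (x∉ here)
∪-insert (false ∷ B) zero    x∉ = cong suc (cong ∣_∣ (∪-identityʳ B))
∪-insert (true ∷ B)  (suc x) x∉ = cong suc (∪-insert B x (x∉ ∘ there))
∪-insert (false ∷ B) (suc x) x∉ = ∪-insert B x (x∉ ∘ there)

∪-absorb : (B : Subset n) (x : Fin n) → x ∈ B → B ∪ ⁅ x ⁆ ≡ B
∪-absorb B x x∈ = ⊆-antisym below (p⊆p∪q ⁅ x ⁆)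
  where
  below : B ∪ ⁅ x ⁆ ⊆ B
  below y∈ with x∈p∪q⁻ B ⁅ x ⁆ y∈
  ... | inj₁ y∈B = y∈B
  ... | inj₂ y∈x with refl ← x∈⁅y⁆⇒x≡y x y∈x = x∈

∪-insert-≤ : (B : Subset n) (x : Fin n) → ∣ B ∪ ⁅ x ⁆ ∣ ≤ suc ∣ B ∣
∪-insert-≤ B x with x ∈? B
... | yes x∈ = ≤-trans (≤-reflexive (cong ∣_∣ (∪-absorb B x x∈))) (n≤1+n _)
... | no x∉  = ≤-reflexive (∪-insert B x x∉)

∪-set-cons : (B : Subset n) (x : Fin n) (w : List (Fin n)) → B ∪ set (x ∷ w) ≡ (B ∪ ⁅ x ⁆) ∪ set w
∪-set-cons B x w = sym (∪-assoc B ⁅ x ⁆ (set w))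

∣∪set∣≤ : (B : Subset n) (w : List (Fin n)) → ∣ B ∪ set w ∣ ≤ ∣ B ∣ + length w
∣∪set∣≤ B []      = ≤-reflexive (trans (cong ∣_∣ (∪-identityʳ B)) (sym (+-identityʳ _)))
∣∪set∣≤ B (x ∷ w) = begin
  ∣ B ∪ set (x ∷ w) ∣       ≡⟨ cong ∣_∣ (∪-set-cons B x w) ⟩
  ∣ (B ∪ ⁅ x ⁆) ∪ set w ∣   ≤⟨ ∣∪set∣≤ (B ∪ ⁅ x ⁆) w ⟩
  ∣ B ∪ ⁅ x ⁆ ∣ + length w  ≤⟨ +-monoˡ-≤ (length w) (∪-insert-≤ B x) ⟩
  suc ∣ B ∣ + length w      ≡⟨ sym (+-suc ∣ B ∣ (length w)) ⟩
  ∣ B ∣ + suc (length w)    ∎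
  where open ≤-Reasoning

-- The letters of w are distinct and lie outside B; this formulation depends on w only through
-- its underlying set and its length.
Distinct : Subset n → List (Fin n) → Set
Distinct B w = ∣ B ∪ set w ∣ ≡ ∣ B ∣ + length w

distinct? : (B : Subset n) → Decidable (Distinct B)
distinct? B w = ∣ B ∪ set w ∣ ≟ ∣ B ∣ + length w

-- Adjoining `u` and then `v` enlarges the set by at most their lengths; equality in total forces
-- equality in both steps.
Distinct-++⁻ : (B : Subset n) (u v : List (Fin n)) → Distinct B (u ++ v) → Distinct B u × Distinct (B ∪ set u) v
Distinct-++⁻ B u v d = du , trans total (cong (_+ length v) (sym du))
  where
  total : ∣ (B ∪ set u) ∪ set v ∣ ≡ ∣ B ∣ + length u + length v
  total = begin
    ∣ (B ∪ set u) ∪ set v ∣        ≡⟨ cong ∣_∣ (trans (∪-assoc B (set u) (set v)) (cong (B ∪_) (sym (set-++ u v)))) ⟩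
    ∣ B ∪ set (u ++ v) ∣           ≡⟨ d ⟩
    ∣ B ∣ + length (u ++ v)        ≡⟨ cong (∣ B ∣ +_) (length-++ u) ⟩
    ∣ B ∣ + (length u + length v)  ≡⟨ sym (+-assoc ∣ B ∣ _ _) ⟩
    ∣ B ∣ + length u + length v    ∎
    where open ≡-Reasoning
  du : ∣ B ∪ set u ∣ ≡ ∣ B ∣ + length u
  du = ≤-antisym (∣∪set∣≤ B u)
    (+-cancelʳ-≤ (length v) _ _ (≤-trans (≤-reflexive (sym total)) (∣∪set∣≤ (B ∪ set u) v)))

Distinct-++⁺ : (B : Subset n) (u v : List (Fin n)) → Distinct B u → Distinct (B ∪ set u) v → Distinct B (u ++ v)
Distinct-++⁺ B u v du dv = begin
  ∣ B ∪ set (u ++ v) ∣           ≡⟨ cong ∣_∣ (trans (cong (B ∪_) (set-++ u v)) (sym (∪-assoc B (set u) (set v)))) ⟩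
  ∣ (B ∪ set u) ∪ set v ∣        ≡⟨ dv ⟩
  ∣ B ∪ set u ∣ + length v       ≡⟨ cong (_+ length v) du ⟩
  ∣ B ∣ + length u + length v    ≡⟨ +-assoc ∣ B ∣ _ _ ⟩
  ∣ B ∣ + (length u + length v)  ≡⟨ cong (∣ B ∣ +_) (sym (length-++ u)) ⟩
  ∣ B ∣ + length (u ++ v)        ∎
  where open ≡-Reasoning

set-singleton : (x : Fin n) → set (x ∷ []) ≡ ⁅ x ⁆
set-singleton x = ∪-identityʳ ⁅ x ⁆

Distinct-∷⁻ : (B : Subset n) (x : Fin n) (w : List (Fin n)) → Distinct B (x ∷ w) → x ∉ B × Distinct (B ∪ ⁅ x ⁆) w
Distinct-∷⁻ B x w d with Distinct-++⁻ B (x ∷ []) w d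
... | dx , dw = (λ x∈ → 1+n≢n (begin
      suc ∣ B ∣              ≡⟨ +-comm 1 ∣ B ∣ ⟩
      ∣ B ∣ + 1              ≡⟨ sym dx ⟩
      ∣ B ∪ set (x ∷ []) ∣   ≡⟨ cong (λ s → ∣ B ∪ s ∣) (set-singleton x) ⟩
      ∣ B ∪ ⁅ x ⁆ ∣          ≡⟨ cong ∣_∣ (∪-absorb B x x∈) ⟩
      ∣ B ∣                  ∎)) , subst (λ s → Distinct (B ∪ s) w) (set-singleton x) dw
  where open ≡-Reasoning

Distinct-∷⁺ : (B : Subset n) (x : Fin n) (w : List (Fin n)) → x ∉ B → Distinct (B ∪ ⁅ x ⁆) w → Distinct B (x ∷ w)
Distinct-∷⁺ B x w x∉ d = Distinct-++⁺ B (x ∷ []) w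
  (trans (cong (λ s → ∣ B ∪ s ∣) (set-singleton x)) (trans (∪-insert B x x∉) (+-comm 1 ∣ B ∣)))
  (subst (λ s → Distinct (B ∪ s) w) (sym (set-singleton x)) d)

Distinct-lookup : (B : Subset n) (y : Vec (Fin n) j) → Distinct B (toList y) →
  (∀ i → lookup y i ∉ B) × (∀ i l → lookup y i ≡ lookup y l → i ≡ l)
Distinct-lookup B []      d = (λ ()) , λ ()
Distinct-lookup B (a ∷ y) d with Distinct-∷⁻ B a (toList y) d
... | a∉ , d′ with Distinct-lookup (B ∪ ⁅ a ⁆) y d′
... | out , inj = out′ , inj′
  where
  a≢ : ∀ i → lookup y i ≢ a
  a≢ i e = out i (x∈p∪q⁺ (inj₂ (subst (_∈ ⁅ a ⁆) (sym e) (x∈⁅x⁆ a))))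
  out′ : ∀ i → lookup (a ∷ y) i ∉ B
  out′ zero    = a∉
  out′ (suc i) = out i ∘ x∈p∪q⁺ ∘ inj₁
  inj′ : ∀ i l → lookup (a ∷ y) i ≡ lookup (a ∷ y) l → i ≡ l
  inj′ zero    zero    e = refl
  inj′ zero    (suc l) e = ⊥-elim (a≢ l (sym e))
  inj′ (suc i) zero    e = ⊥-elim (a≢ i e)
  inj′ (suc i) (suc l) e = cong suc (inj i l e)

∈-set⁻ : (y : Vec (Fin n) j) {a : Fin n} → a ∈ set (toList y) → ∃ λ i → lookup y i ≡ a
∈-set⁻ []      a∈ = ⊥-elim (∉⊥ a∈)
∈-set⁻ (b ∷ y) a∈ with x∈p∪q⁻ ⁅ b ⁆ (set (toList y)) a∈
... | inj₁ p = zero , sym (x∈⁅y⁆⇒x≡y b p)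
... | inj₂ p = let i , e = ∈-set⁻ y p in suc i , e

∈-set⁺ : (y : Vec (Fin n) j) (i : Fin j) → lookup y i ∈ set (toList y)
∈-set⁺ (b ∷ y) zero    = x∈p∪q⁺ (inj₁ (x∈⁅x⁆ b))
∈-set⁺ (b ∷ y) (suc i) = x∈p∪q⁺ (inj₂ (∈-set⁺ y i))

-- Differences of two extensions of a chain

image : Subset j → Vec (Fin n) j → Subset n
image []          []      = ⊥
image (true ∷ V)  (a ∷ y) = image V y ∪ ⁅ a ⁆
image (false ∷ V) (a ∷ y) = image V y

∈-image⁻ : (V : Subset j) (y : Vec (Fin n) j) {a : Fin n} → a ∈ image V y →
  ∃ λ i → lookup V i ≡ inside × lookup y i ≡ a
∈-image⁻ []          []      a∈ = ⊥-elim (∉⊥ a∈)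
∈-image⁻ (true ∷ V)  (b ∷ y) a∈ with x∈p∪q⁻ (image V y) ⁅ b ⁆ a∈
... | inj₁ p = let i , i∈ , e = ∈-image⁻ V y p in suc i , i∈ , e
... | inj₂ p = zero , refl , sym (x∈⁅y⁆⇒x≡y b p)
∈-image⁻ (false ∷ V) (b ∷ y) a∈ = let i , i∈ , e = ∈-image⁻ V y a∈ in suc i , i∈ , e

∈-image⁺ : (V : Subset j) (y : Vec (Fin n) j) (i : Fin j) → lookup V i ≡ inside → lookup y i ∈ image V y
∈-image⁺ (true ∷ V)  (b ∷ y) zero    _  = x∈p∪q⁺ (inj₂ (x∈⁅x⁆ b))
∈-image⁺ (true ∷ V)  (b ∷ y) (suc i) i∈ = x∈p∪q⁺ (inj₁ (∈-image⁺ V y i i∈))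
∈-image⁺ (false ∷ V) (b ∷ y) (suc i) i∈ = ∈-image⁺ V y i i∈

size-image : (V : Subset j) (y : Vec (Fin n) j) → (∀ i l → lookup y i ≡ lookup y l → i ≡ l) →
  ∣ image V y ∣ ≡ ∣ V ∣
size-image {n = n} [] []   _   = ∣⊥∣≡0 n
size-image (true ∷ V)  (a ∷ y) inj = trans
  (∪-insert (image V y) a (λ a∈ → let i , _ , e = ∈-image⁻ V y a∈ in Fin.0≢1+n (inj zero (suc i) (sym e))))
  (cong suc (size-image V y (λ i l e → Fin.suc-injective (inj (suc i) (suc l) e))))
size-image (false ∷ V) (a ∷ y) inj = size-image V y (λ i l e → Fin.suc-injective (inj (suc i) (suc l) e))

x∈p─q⇒x∉q : (p q : Subset n) {x : Fin n} → x ∈ p ─ q → x ∉ q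
x∈p─q⇒x∉q (true ∷ p) (true ∷ q)  () here
x∈p─q⇒x∉q (false ∷ p) (true ∷ q) () here
x∈p─q⇒x∉q (a ∷ p) (b ∷ q) (there x∈) (there x∈q) = x∈p─q⇒x∉q p q x∈ x∈q

-- The difference is the set of entries of `y` on `V`: `T` vanishes in `T′`, entries off `V` are
-- shared with `y′`, and entries on `V` avoid `T′` by distinctness and `y′` by assumption. They are
-- distinct, so there are `∣ V ∣` of them.
size-difference : (T T′ : Subset n) (V : Subset j) (y y′ : Vec (Fin n) j) → T ⊆ T′ →
  Distinct T′ (toList y) → y ≗ y′ off V → (∀ i → lookup V i ≡ inside → ∀ l → lookup y i ≢ lookup y′ l) →
  ∣ (T ∪ set (toList y)) ─ (T′ ∪ set (toList y′)) ∣ ≡ ∣ V ∣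
size-difference T T′ V y y′ T⊆T′ dist off new =
  trans (cong ∣_∣ (⊆-antisym fwd bwd)) (size-image V y (proj₂ (Distinct-lookup T′ y dist)))
  where
  A = T ∪ set (toList y)
  A′ = T′ ∪ set (toList y′)
  fwd : A ─ A′ ⊆ image V y
  fwd {a} a∈ with x∈p∪q⁻ T (set (toList y)) (p─q⊆p A A′ a∈)
  ... | inj₁ a∈T = ⊥-elim (x∈p─q⇒x∉q A A′ a∈ (x∈p∪q⁺ (inj₁ (T⊆T′ a∈T))))
  ... | inj₂ a∈y with ∈-set⁻ y a∈y
  ...   | i , refl with lookup V i in eq
  ...     | true  = ∈-image⁺ V y i eq
  ...     | false = ⊥-elim (x∈p─q⇒x∉q A A′ a∈ (x∈p∪q⁺ (inj₂ (subst (_∈ set (toList y′)) (sym (off i eq)) (∈-set⁺ y′ i)))))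
  bwd : image V y ⊆ A ─ A′
  bwd a∈ with ∈-image⁻ V y a∈
  ... | i , i∈ , refl = x∈p∧x∉q⇒x∈p─q (x∈p∪q⁺ (inj₂ (∈-set⁺ y i))) out
    where
    out : lookup y i ∉ A′
    out p with x∈p∪q⁻ T′ (set (toList y′)) p
    ... | inj₁ q = proj₁ (Distinct-lookup T′ y dist) i q
    ... | inj₂ q = let l , e = ∈-set⁻ y′ q in new i i∈ l (sym e)

take-⊆ : ∀ s s′ → s ≤ s′ → (z : List (Fin n)) → set (take s z) ⊆ set (take s′ z)
take-⊆ zero    s′       _         z       a∈ = ⊥-elim (∉⊥ a∈)
take-⊆ (suc s) (suc s′) (s≤s le) []      a∈ = a∈
take-⊆ (suc s) (suc s′) (s≤s le) (x ∷ z) a∈ with x∈p∪q⁻ ⁅ x ⁆ (set (take s z)) a∈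
... | inj₁ p = x∈p∪q⁺ (inj₁ p)
... | inj₂ p = x∈p∪q⁺ (inj₂ (take-⊆ s s′ le z p))

take-⊆-all : ∀ s (z : List (Fin n)) → set (take s z) ⊆ set z
take-⊆-all zero    z       a∈ = ⊥-elim (∉⊥ a∈)
take-⊆-all (suc s) []      a∈ = a∈
take-⊆-all (suc s) (x ∷ z) a∈ with x∈p∪q⁻ ⁅ x ⁆ (set (take s z)) a∈
... | inj₁ p = x∈p∪q⁺ (inj₁ p)
... | inj₂ p = x∈p∪q⁺ (inj₂ (take-⊆-all s z p))

Distinct-⊆ : (T B : Subset n) → T ⊆ B → (w : List (Fin n)) → Distinct B w → Distinct T w
Distinct-⊆ T B T⊆B []      d = trans (cong ∣_∣ (∪-identityʳ T)) (sym (+-identityʳ _))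
Distinct-⊆ T B T⊆B (x ∷ w) d with Distinct-∷⁻ B x w d
... | x∉ , d′ = Distinct-∷⁺ T x w (x∉ ∘ T⊆B) (Distinct-⊆ (T ∪ ⁅ x ⁆) (B ∪ ⁅ x ⁆) mono w d′)
  where
  mono : T ∪ ⁅ x ⁆ ⊆ B ∪ ⁅ x ⁆
  mono p with x∈p∪q⁻ T ⁅ x ⁆ p
  ... | inj₁ q = x∈p∪q⁺ (inj₁ (T⊆B q))
  ... | inj₂ q = x∈p∪q⁺ (inj₂ q)

localConstant : (k j : ℕ) → ℕ
localConstant k j = tupleConstant k j (2 ^ j * k)

-- Only one of the two differences has size k: that of the extension of the smaller member of the chain.
extension-bound : (k : ℕ) → k + 2 ^ k * k ≤ j → {ℱ : List (Subset n)} → AvoidsDiff k ℱ →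
  (z : List (Fin n)) {Φ : Vec (Fin n) j → Set} (Φ? : Decidable Φ) →
  (∀ {y} → Φ y → Distinct (set z) (toList y) × ∃ λ s → (set (take s z) ∪ set (toList y)) ∈ˡ ℱ) →
  n ^ k * ∑ (tuples n j) (λ y → ind (Φ? y)) ≤ localConstant k j * n ^ j
extension-bound {j = j} {n = n} k k≤j {ℱ} avoid z {Φ} Φ? h = tuple-bound k k≤j Φ? no-pair
  where
  no-pair : ∀ {y} → Φ y → ¬ Reaches k Φ? y
  no-pair {y} φ (y′ , V , φ′ , size , off , new) with h φ | h φ′
  ... | dist , s , A∈ | dist′ , s′ , A′∈ with ≤-total s s′
  ...   | inj₁ s≤s′ = avoid A∈ A′∈ (trans
          (size-difference _ _ V y y′ (take-⊆ s s′ s≤s′ z) (Distinct-⊆ _ _ (take-⊆-all s′ z) (toList y) dist)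
            (λ i o → sym (off i o)) sym-new) size)
    where
    -- Freshness only says that `y′` on `V` avoids `y`; the other direction is needed too. If `y` at
    -- `i` equals `y′` at `l`, then either `l` is in `V`, against freshness, or `y′` agrees with `y`
    -- at `l`, and distinctness of `y` gives `i ≡ l`.
    sym-new : ∀ i → lookup V i ≡ inside → ∀ l → lookup y i ≢ lookup y′ l
    sym-new i i∈ l e with lookup V l in eq
    ... | true  = new l eq i (sym e)
    ... | false with refl ← proj₂ (Distinct-lookup (set z) y dist) i l (trans e (off l eq))
                with () ← trans (sym i∈) eq
  ...   | inj₂ s′≤s = avoid A′∈ A∈ (trans
          (size-difference _ _ V y′ y (take-⊆ s′ s s′≤s z) (Distinct-⊆ _ _ (take-⊆-all s z) (toList y′) dist′) off new) size)

-- Counting words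

ind-× : {P Q : Set} (d : Dec P) (e : Dec Q) → ind (d ×-dec e) ≡ ind d * ind e
ind-× (yes _) (yes _) = refl
ind-× (yes _) (no _)  = refl
ind-× (no _)  (yes _) = refl
ind-× (no _)  (no _)  = refl

words : (n l : ℕ) → List (List (Fin n))
words n l = map toList (tuples n l)

∑-words : ∀ n l (f : List (Fin n) → ℕ) → ∑ (words n l) f ≡ ∑ (tuples n l) (f ∘ toList)
∑-words n l f = ∑-map toList (tuples n l) f

∑-words-suc : ∀ n l (f : List (Fin n) → ℕ) →
  ∑ (words n (suc l)) f ≡ ∑ (allFin n) (λ x → ∑ (words n l) (λ w → f (x ∷ w)))
∑-words-suc n l f = trans (∑-words n (suc l) f) (trans (∑-vecs-suc (allFin n) l _)
  (∑-cong (allFin n) (λ x → sym (∑-words n l (λ w → f (x ∷ w))))))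

∑-words-+ : ∀ n a b (f : List (Fin n) → ℕ) →
  ∑ (words n (a + b)) f ≡ ∑ (words n a) (λ u → ∑ (words n b) (λ v → f (u ++ v)))
∑-words-+ n zero    b f = sym (+-identityʳ _)
∑-words-+ n (suc a) b f = trans (∑-words-suc n (a + b) f) (trans
  (∑-cong (allFin n) (λ x → ∑-words-+ n a b (λ w → f (x ∷ w))))
  (sym (∑-words-suc n a (λ u → ∑ (words n b) (λ v → f (u ++ v))))))

length-word : ∀ l {w : List (Fin n)} → w ∈ˡ words n l → length w ≡ l
length-word l w∈ with ∈-map⁻ toList w∈
... | v , _ , refl = length-toList v

-- The falling factorial; truncated subtraction makes it 0 for `l` above `m`, in line with there
-- being no such words.
falling : ℕ → ℕ → ℕ
falling m zero    = 1
falling m (suc l) = m * falling (m ∸ 1) l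

falling-+ : ∀ m a b → falling m (a + b) ≡ falling m a * falling (m ∸ a) b
falling-+ m zero    b = sym (+-identityʳ _)
falling-+ m (suc a) b = begin
  m * falling (m ∸ 1) (a + b)                    ≡⟨ cong (m *_) (falling-+ (m ∸ 1) a b) ⟩
  m * (falling (m ∸ 1) a * falling (m ∸ 1 ∸ a) b) ≡⟨ sym (*-assoc m _ _) ⟩
  m * falling (m ∸ 1) a * falling (m ∸ 1 ∸ a) b  ≡⟨ cong (λ e → m * falling (m ∸ 1) a * falling e b) (∸-+-assoc m 1 a) ⟩
  m * falling (m ∸ 1) a * falling (m ∸ suc a) b  ∎
  where open ≡-Reasoning

falling-self : ∀ m → falling m m ≡ m !
falling-self zero    = refl
falling-self (suc m) = cong (suc m *_) (falling-self m)

falling-C : ∀ {a n} → a ≤ n → falling n a ≡ (n C a) * falling a a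
falling-C {a} {n} a≤n = *-cancelʳ-≡ _ _ ((n ∸ a) !) (begin
  falling n a * (n ∸ a) !             ≡⟨ cong (falling n a *_) (sym (falling-self (n ∸ a))) ⟩
  falling n a * falling (n ∸ a) (n ∸ a) ≡⟨ sym (falling-+ n a (n ∸ a)) ⟩
  falling n (a + (n ∸ a))             ≡⟨ cong (falling n) (m+[n∸m]≡n a≤n) ⟩
  falling n n                         ≡⟨ falling-self n ⟩
  n !                                 ≡⟨ sym (m/n*n≡m (k![n∸k]!∣n! a≤n)) ⟩
  n ! / (a ! * (n ∸ a) !) * (a ! * (n ∸ a) !) ≡⟨ cong (_* (a ! * (n ∸ a) !)) (sym (nCk≡n!/k![n-k]! a≤n)) ⟩
  (n C a) * (a ! * (n ∸ a) !)         ≡⟨ sym (*-assoc (n C a) _ _) ⟩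
  (n C a) * a ! * (n ∸ a) !           ≡⟨ cong (λ e → (n C a) * e * (n ∸ a) !) (sym (falling-self a)) ⟩
  (n C a) * falling a a * (n ∸ a) !   ∎)
  where
  open ≡-Reasoning
  instance
    _ : NonZero ((n ∸ a) !)
    _ = (n ∸ a) !≢0
    _ : NonZero (a ! * (n ∸ a) !)
    _ = a !* (n ∸ a) !≢0

falling-pos : ∀ {m} l → l ≤ m → 1 ≤ falling m l
falling-pos         zero    _         = ≤-refl
falling-pos {suc m} (suc l) (s≤s l≤m) = *-mono-≤ {1} {suc m} (s≤s z≤n) (falling-pos l l≤m)

-- Each of the `l` factors of `falling m l` is at least `m ∸ l`, hence at least a quarter of `n`.
falling-≥ : ∀ n m l → n ≤ 4 * (m ∸ l) → n ^ l ≤ 4 ^ l * falling m l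
falling-≥ n m zero    _ = ≤-refl
falling-≥ n m (suc l) h = begin
  n * n ^ l                             ≤⟨ *-mono-≤ (≤-trans h (*-monoʳ-≤ 4 (m∸n≤m m (suc l))))
                                             (falling-≥ n (m ∸ 1) l (≤-trans h (≤-reflexive (cong (4 *_) (sym (∸-+-assoc m 1 l)))))) ⟩
  4 * m * (4 ^ l * falling (m ∸ 1) l)   ≡⟨ [m*n]*[o*p]≡[m*o]*[n*p] 4 m (4 ^ l) _ ⟩
  4 ^ suc l * falling m (suc l)         ∎
  where open ≤-Reasoning

count-outside : (B : Subset n) → ∑ (allFin n) (λ x → ind (lookup B x Bool.≟ outside)) ≡ n ∸ ∣ B ∣
count-outside {n} B = begin
  ∑ (allFin n) g                      ≡⟨ sym (m+n∸n≡m _ ∣ B ∣) ⟩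
  ∑ (allFin n) g + ∣ B ∣ ∸ ∣ B ∣      ≡⟨ cong (_∸ ∣ B ∣) (outside-complement B) ⟩
  n ∸ ∣ B ∣                           ∎
  where
  open ≡-Reasoning
  g : Fin n → ℕ
  g x = ind (lookup B x Bool.≟ outside)

count-distinct : ∀ l (B : Subset n) → ∑ (words n l) (λ w → ind (distinct? B w)) ≡ falling (n ∸ ∣ B ∣) l
count-distinct zero B = trans (+-identityʳ _)
  (ind-yes (distinct? B []) (trans (cong ∣_∣ (∪-identityʳ B)) (sym (+-identityʳ _))))
count-distinct {n} (suc l) B = begin
  ∑ (words n (suc l)) (λ w → ind (distinct? B w))
    ≡⟨ ∑-words-suc n l _ ⟩
  ∑ (allFin n) (λ x → ∑ (words n l) (λ w → ind (distinct? B (x ∷ w))))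
    ≡⟨ ∑-cong (allFin n) first ⟩
  ∑ (allFin n) (λ x → ind (lookup B x Bool.≟ outside) * falling (n ∸ ∣ B ∣ ∸ 1) l)
    ≡⟨ ∑-*ʳ (allFin n) _ _ ⟩
  ∑ (allFin n) (λ x → ind (lookup B x Bool.≟ outside)) * falling (n ∸ ∣ B ∣ ∸ 1) l
    ≡⟨ cong (_* falling (n ∸ ∣ B ∣ ∸ 1) l) (count-outside B) ⟩
  (n ∸ ∣ B ∣) * falling (n ∸ ∣ B ∣ ∸ 1) l ∎
  where
  open ≡-Reasoning
  first : ∀ x → ∑ (words n l) (λ w → ind (distinct? B (x ∷ w)))
              ≡ ind (lookup B x Bool.≟ outside) * falling (n ∸ ∣ B ∣ ∸ 1) l
  first x with lookup B x in eq
  ... | true  = trans (∑-cong (words n l) (λ w → ind-no (distinct? B (x ∷ w))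
                  (λ d → proj₁ (Distinct-∷⁻ B x w d) (lookup⇒[]= x B eq)))) (∑-zero (words n l))
  ... | false = begin
      ∑ (words n l) (λ w → ind (distinct? B (x ∷ w)))
        ≡⟨ ∑-cong (words n l) (λ w → ≤-antisym
             (ind-mono (distinct? B (x ∷ w)) (distinct? (B ∪ ⁅ x ⁆) w) (proj₂ ∘ Distinct-∷⁻ B x w))
             (ind-mono (distinct? (B ∪ ⁅ x ⁆) w) (distinct? B (x ∷ w)) (Distinct-∷⁺ B x w x∉))) ⟩
      ∑ (words n l) (λ w → ind (distinct? (B ∪ ⁅ x ⁆) w))
        ≡⟨ count-distinct l (B ∪ ⁅ x ⁆) ⟩
      falling (n ∸ ∣ B ∪ ⁅ x ⁆ ∣) l
        ≡⟨ cong (λ e → falling e l) (begin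
             n ∸ ∣ B ∪ ⁅ x ⁆ ∣  ≡⟨ cong (n ∸_) (trans (∪-insert B x x∉) (+-comm 1 ∣ B ∣)) ⟩
             n ∸ (∣ B ∣ + 1)    ≡⟨ sym (∸-+-assoc n ∣ B ∣ 1) ⟩
             n ∸ ∣ B ∣ ∸ 1      ∎) ⟩
      falling (n ∸ ∣ B ∣ ∸ 1) l
        ≡⟨ sym (*-identityˡ _) ⟩
      1 * falling (n ∸ ∣ B ∣ ∸ 1) l ∎
    where
    x∉ : x ∉ B
    x∉ x∈ with () ← trans (sym eq) ([]=⇒lookup x∈)

Distinct-disjoint : (B : Subset n) (w : List (Fin n)) → Distinct B w → ∀ {a} → a ∈ set w → a ∉ B
Distinct-disjoint B []      d a∈ = ⊥-elim (∉⊥ a∈)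
Distinct-disjoint B (x ∷ w) d a∈ with Distinct-∷⁻ B x w d | x∈p∪q⁻ ⁅ x ⁆ (set w) a∈
... | x∉ , _  | inj₁ p with refl ← x∈⁅y⁆⇒x≡y x p = x∉
... | _  , d′ | inj₂ p = Distinct-disjoint (B ∪ ⁅ x ⁆) w d′ p ∘ x∈p∪q⁺ ∘ inj₁

-- The letters avoid `∁ A`, and by counting they fill up everything else.
Distinct-∁⇒set : (A : Subset n) (w : List (Fin n)) → length w ≡ ∣ A ∣ → Distinct (∁ A) w → set w ≡ A
Distinct-∁⇒set {n} A w len d = ⊆-antisym (λ a∈ → x∉∁p⇒x∈p (Distinct-disjoint (∁ A) w d a∈)) above
  where
  full : ∁ A ∪ set w ≡ ⊤
  full = ∣p∣≡n⇒p≡⊤ (trans d (trans (cong₂ _+_ (∣∁p∣≡n∸∣p∣ A) len) (m∸n+n≡m (∣p∣≤n A))))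
  above : A ⊆ set w
  above {a} a∈ with x∈p∪q⁻ (∁ A) (set w) (subst (a ∈_) (sym full) ∈⊤)
  ... | inj₁ p = ⊥-elim (x∈∁p⇒x∉p p a∈)
  ... | inj₂ p = p

Distinct-cong : (B : Subset n) {w w′ : List (Fin n)} → set w ≡ set w′ → length w ≡ length w′ →
  Distinct B w → Distinct B w′
Distinct-cong B {w} {w′} s len d =
  trans (cong (λ e → ∣ B ∪ e ∣) (sym s)) (trans d (cong (∣ B ∣ +_) len))

take-++-exact : ∀ t (u v : List (Fin n)) → length u ≡ t → take t (u ++ v) ≡ u
take-++-exact zero    []      v _ = refl
take-++-exact (suc t) (x ∷ u) v e = cong (x ∷_) (take-++-exact t u v (suc-injective e))

take-++-≤ : ∀ t (u v : List (Fin n)) → t ≤ length u → take t (u ++ v) ≡ take t u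
take-++-≤ zero    u       v _        = refl
take-++-≤ (suc t) (x ∷ u) v (s≤s le) = cong (x ∷_) (take-++-≤ t u v le)

count-words-of : (A : Subset n) → ∑ (words n ∣ A ∣) (λ w → ind (distinct? (∁ A) w)) ≡ falling ∣ A ∣ ∣ A ∣
count-words-of {n} A = trans (count-distinct ∣ A ∣ (∁ A))
  (cong (λ e → falling e ∣ A ∣) (trans (cong (n ∸_) (∣∁p∣≡n∸∣p∣ A)) (m∸[m∸n]≡n (∣p∣≤n A))))

interleave : (u v x : List (Fin n)) → set ((u ++ x) ++ v) ≡ set ((u ++ v) ++ x)
interleave u v x = begin
  set ((u ++ x) ++ v)      ≡⟨ trans (set-++ (u ++ x) v) (cong (_∪ set v) (set-++ u x)) ⟩
  (set u ∪ set x) ∪ set v  ≡⟨ ∪-assoc (set u) (set x) (set v) ⟩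
  set u ∪ (set x ∪ set v)  ≡⟨ cong (set u ∪_) (∪-comm (set x) (set v)) ⟩
  set u ∪ (set v ∪ set x)  ≡⟨ sym (∪-assoc (set u) (set v) (set x)) ⟩
  (set u ∪ set v) ∪ set x  ≡⟨ sym (trans (set-++ (u ++ v) x) (cong (_∪ set x) (set-++ u v))) ⟩
  set ((u ++ v) ++ x)      ∎
  where open ≡-Reasoning

interleave-length : (u v x : List (Fin n)) → length ((u ++ x) ++ v) ≡ length ((u ++ v) ++ x)
interleave-length u v x = begin
  length ((u ++ x) ++ v)            ≡⟨ trans (length-++ (u ++ x)) (cong (_+ length v) (length-++ u)) ⟩
  length u + length x + length v    ≡⟨ +-assoc (length u) _ _ ⟩
  length u + (length x + length v)  ≡⟨ cong (length u +_) (+-comm (length x) (length v)) ⟩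
  length u + (length v + length x)  ≡⟨ sym (+-assoc (length u) _ _) ⟩
  length u + length v + length x    ≡⟨ sym (trans (length-++ (u ++ v)) (cong (_+ length x) (length-++ u))) ⟩
  length ((u ++ v) ++ x)            ∎
  where open ≡-Reasoning

spells? : ∀ t (A : Subset n) (z x : List (Fin n)) → Dec (Distinct ⊥ (z ++ x) × set (take t z) ∪ set x ≡ A)
spells? t A z x = distinct? ⊥ (z ++ x) ×-dec ((set (take t z) ∪ set x) ≟ˢ A)

-- Write `z` as `u ++ v` with `u` of length `t`. If `u ++ x` is any ordering of `A` and `v` any word
-- of distinct letters outside `A`, then `z` and `x` spell `A` at `t`. The left side counts these
-- choices.
spelling-count : ∀ t r j (A : Subset n) → ∣ A ∣ ≡ t + j →
  falling ∣ A ∣ ∣ A ∣ * falling (n ∸ ∣ A ∣) r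
    ≤ ∑ (words n (t + r)) (λ z → ∑ (words n j) (λ x → ind (spells? t A z x)))
spelling-count {n} t r j A size = begin
  falling ∣ A ∣ ∣ A ∣ * falling (n ∸ ∣ A ∣) r
    ≡⟨ cong₂ _*_ (sym (count-words-of A)) (sym (count-distinct r A)) ⟩
  ∑ (words n ∣ A ∣) (λ w → ind (distinct? (∁ A) w)) * V
    ≡⟨ cong (λ s → ∑ (words n s) (λ w → ind (distinct? (∁ A) w)) * V) size ⟩
  ∑ (words n (t + j)) (λ w → ind (distinct? (∁ A) w)) * V
    ≡⟨ cong (_* V) (∑-words-+ n t j _) ⟩
  ∑ (words n t) (λ u → ∑ (words n j) (λ x → ind (distinct? (∁ A) (u ++ x)))) * V
    ≡⟨ sym (trans (∑-cong (words n t) (λ u → ∑-*ʳ (words n j) V _)) (∑-*ʳ (words n t) V _)) ⟩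
  ∑ (words n t) (λ u → ∑ (words n j) (λ x → ind (distinct? (∁ A) (u ++ x)) * V))
    ≤⟨ ∑-mono-∈ (words n t) (λ {u} u∈ → begin
         ∑ (words n j) (λ x → ind (distinct? (∁ A) (u ++ x)) * V)
           ≡⟨ sym (∑-cong (words n j) (λ x → ∑-*ˡ (words n r) (ind (distinct? (∁ A) (u ++ x))) _)) ⟩
         ∑ (words n j) (λ x → ∑ (words n r) (λ v → ind (distinct? (∁ A) (u ++ x)) * ind (distinct? A v)))
           ≤⟨ ∑-mono-∈ (words n j) (λ {x} x∈ → ∑-mono (words n r) (λ v → pointwise u∈ x∈ v)) ⟩
         ∑ (words n j) (λ x → ∑ (words n r) (λ v → ind (spells? t A (u ++ v) x)))
           ≡⟨ ∑-swap (words n j) (words n r) _ ⟩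
         ∑ (words n r) (λ v → ∑ (words n j) (λ x → ind (spells? t A (u ++ v) x))) ∎) ⟩
  ∑ (words n t) (λ u → ∑ (words n r) (λ v → ∑ (words n j) (λ x → ind (spells? t A (u ++ v) x))))
    ≡⟨ sym (∑-words-+ n t r _) ⟩
  ∑ (words n (t + r)) (λ z → ∑ (words n j) (λ x → ind (spells? t A z x))) ∎
  where
  open ≤-Reasoning
  V : ℕ
  V = ∑ (words n r) (λ v → ind (distinct? A v))
  pointwise : ∀ {u x} → u ∈ˡ words n t → x ∈ˡ words n j → ∀ v →
    ind (distinct? (∁ A) (u ++ x)) * ind (distinct? A v) ≤ ind (spells? t A (u ++ v) x)
  pointwise {u} {x} u∈ x∈ v = ≤-trans
    (≤-reflexive (sym (ind-× (distinct? (∁ A) (u ++ x)) (distinct? A v))))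
    (ind-mono (distinct? (∁ A) (u ++ x) ×-dec distinct? A v) (spells? t A (u ++ v) x) spell)
    where
    spell : Distinct (∁ A) (u ++ x) × Distinct A v → Distinct ⊥ ((u ++ v) ++ x) × set (take t (u ++ v)) ∪ set x ≡ A
    spell (d , d′) =
      Distinct-cong ⊥ {(u ++ x) ++ v} {(u ++ v) ++ x} (interleave u v x) (interleave-length u v x)
        (Distinct-++⁺ ⊥ (u ++ x) v (Distinct-⊆ ⊥ (∁ A) (⊥-elim ∘ ∉⊥) (u ++ x) d)
          (subst (λ B → Distinct B v) (sym (trans (∪-identityˡ _) is-A)) d′)) ,
      trans (cong (λ e → set e ∪ set x) (take-++-exact t u v (length-word t u∈))) (trans (sym (set-++ u x)) is-A)
      where
      is-A : set (u ++ x) ≡ A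
      is-A = Distinct-∁⇒set A (u ++ x)
        (trans (length-++ u) (trans (cong₂ _+_ (length-word t u∈) (length-word j x∈)) (sym size))) d

-- Chains hitting the family

-- `a` pays for the first hit. Every later hit has an earlier one and is charged to the pair they
-- form.
first-or-pair : ∀ N (h : ℕ → ℕ) (a : ℕ) → (∀ i → h i ≤ 1) → (∀ {i} → i < N → h i ≤ a) →
  ∑ (downFrom N) h ≤ a + ∑ (downFrom N) (λ i′ → ∑ (downFrom i′) (λ i → h i * h i′))
first-or-pair zero    h a h≤1 h≤a = z≤n
first-or-pair (suc N) h a h≤1 h≤a with ∑ (downFrom N) h in eq
... | zero = begin
    h N + 0  ≡⟨ +-identityʳ (h N) ⟩
    h N      ≤⟨ h≤a ≤-refl ⟩
    a        ≤⟨ m≤m+n a _ ⟩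
    a + ∑ (downFrom (suc N)) (λ i′ → ∑ (downFrom i′) (λ i → h i * h i′)) ∎
  where open ≤-Reasoning
... | suc m = begin
    h N + suc m
      ≡⟨ cong (h N +_) (sym eq) ⟩
    h N + ∑ (downFrom N) h
      ≤⟨ +-mono-≤ last (first-or-pair N h a h≤1 (h≤a ∘ m≤n⇒m≤1+n)) ⟩
    P N + (a + ∑ (downFrom N) P)
      ≡⟨ solve 3 (λ p a s → p :+ (a :+ s) := a :+ (p :+ s)) refl (P N) a (∑ (downFrom N) P) ⟩
    a + (P N + ∑ (downFrom N) P) ∎
  where
  open ≤-Reasoning
  open +-*-Solver
  P : ℕ → ℕ
  P i′ = ∑ (downFrom i′) (λ i → h i * h i′)
  last : h N ≤ P N
  last = begin
    h N                         ≡⟨ sym (*-identityˡ (h N)) ⟩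
    1 * h N                     ≤⟨ *-monoˡ-≤ (h N) (≤-trans (s≤s z≤n) (≤-reflexive (sym eq))) ⟩
    ∑ (downFrom N) h * h N      ≡⟨ sym (∑-*ʳ (downFrom N) (h N) h) ⟩
    P N                         ∎

∑-downFrom-mono : ∀ {M N} (f : ℕ → ℕ) → M ≤ N → ∑ (downFrom M) f ≤ ∑ (downFrom N) f
∑-downFrom-mono {zero}  f _ = z≤n
∑-downFrom-mono {suc M} {suc N} f (s≤s M≤N) with m≤n⇒m<n∨m≡n M≤N
... | inj₁ M<N  = ≤-trans (∑-downFrom-mono {suc M} {N} f M<N) (m≤n+m _ (f N))
... | inj₂ refl = ≤-refl

length-downFrom : ∀ N → length (downFrom N) ≡ N
length-downFrom zero    = refl
length-downFrom (suc N) = cong suc (length-downFrom N)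

∑-rotate : {A B C : Set} (ys : List A) (vs : List B) (xs : List C) (g : A → B → C → ℕ) →
  ∑ ys (λ y → ∑ vs (λ v → ∑ xs (λ x → g y v x))) ≡ ∑ vs (λ v → ∑ xs (λ x → ∑ ys (λ y → g y v x)))
∑-rotate ys vs xs g = trans (∑-swap ys vs _) (∑-cong vs (λ v → ∑-swap ys xs _))

module Family (k j : ℕ) (k≤j : k + 2 ^ k * k ≤ j) {n : ℕ} {ℱ : List (Subset n)} (avoid : AvoidsDiff k ℱ) where

  _∈ℱ? : (A : Subset n) → Dec (A ∈ˡ ℱ)
  A ∈ℱ? = DecMembership._∈?_ _≟ˢ_ A ℱ

  Hits : ℕ → List (Fin n) → List (Fin n) → Set
  Hits t z x = Distinct ⊥ (z ++ x) × (set (take t z) ∪ set x) ∈ˡ ℱ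

  hits? : ∀ t z x → Dec (Hits t z x)
  hits? t z x = distinct? ⊥ (z ++ x) ×-dec ((set (take t z) ∪ set x) ∈ℱ?)

  hits : ℕ → List (Fin n) → List (Fin n) → ℕ
  hits t z x = ind (hits? t z x)

  totalHits : (L t : ℕ) → ℕ
  totalHits L t = ∑ (words n L) (λ z → ∑ (words n j) (hits t z))

  c₀ : ℕ
  c₀ = localConstant k j

  word-extension-bound : (z : List (Fin n)) {Φ : List (Fin n) → Set} (Φ? : Decidable Φ) →
    (∀ {y} → Φ y → Distinct (set z) y × ∃ λ s → (set (take s z) ∪ set y) ∈ˡ ℱ) →
    n ^ k * ∑ (words n j) (λ y → ind (Φ? y)) ≤ c₀ * n ^ j
  word-extension-bound z Φ? h = ≤-trans (≤-reflexive (cong (n ^ k *_) (∑-words n j _)))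
    (extension-bound k k≤j avoid z (Φ? ∘ toList) h)

  HitsSome : List ℕ → List (Fin n) → List (Fin n) → Set
  HitsSome ts z x = Distinct ⊥ (z ++ x) × Any (λ t → (set (take t z) ∪ set x) ∈ˡ ℱ) ts

  hitsSome? : ∀ ts z x → Dec (HitsSome ts z x)
  hitsSome? ts z x = distinct? ⊥ (z ++ x) ×-dec any? (λ t → (set (take t z) ∪ set x) ∈ℱ?) ts

  -- For fixed `z` the local bound treats all positions at once, as their sets form a chain; hence
  -- no factor `length ts` appears. The distinct words `z` number `falling n L`.
  hitsSome-bound : ∀ L ts →
    n ^ k * ∑ (words n L) (λ z → ∑ (words n j) (λ x → ind (hitsSome? ts z x))) ≤ falling n L * (c₀ * n ^ j)
  hitsSome-bound L ts = begin
    n ^ k * ∑ (words n L) (λ z → ∑ (words n j) (λ x → ind (hitsSome? ts z x)))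
      ≡⟨ sym (∑-*ˡ (words n L) (n ^ k) _) ⟩
    ∑ (words n L) (λ z → n ^ k * ∑ (words n j) (λ x → ind (hitsSome? ts z x)))
      ≤⟨ ∑-mono (words n L) per-chain ⟩
    ∑ (words n L) (λ z → ind (distinct? ⊥ z) * (c₀ * n ^ j))
      ≡⟨ ∑-*ʳ (words n L) (c₀ * n ^ j) _ ⟩
    ∑ (words n L) (λ z → ind (distinct? ⊥ z)) * (c₀ * n ^ j)
      ≡⟨ cong (_* (c₀ * n ^ j)) (trans (count-distinct L ⊥) (cong (λ e → falling (n ∸ e) L) (∣⊥∣≡0 n))) ⟩
    falling n L * (c₀ * n ^ j) ∎
    where
    open ≤-Reasoning
    per-chain : ∀ z → n ^ k * ∑ (words n j) (λ x → ind (hitsSome? ts z x)) ≤ ind (distinct? ⊥ z) * (c₀ * n ^ j)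
    per-chain z with distinct? ⊥ z
    ... | no ¬d = ≤-reflexive (trans (cong (n ^ k *_) (trans
            (∑-cong (words n j) (λ x → ind-no (hitsSome? ts z x) (¬d ∘ proj₁ ∘ Distinct-++⁻ ⊥ z x ∘ proj₁)))
            (∑-zero (words n j)))) (*-zeroʳ (n ^ k)))
    ... | yes _ = ≤-trans
            (word-extension-bound z (hitsSome? ts z) (λ {y} (d , a) →
              subst (λ B → Distinct B y) (∪-identityˡ (set z)) (proj₂ (Distinct-++⁻ ⊥ z y d)) ,
              let t , _ , m = find a in t , m))
            (≤-reflexive (sym (*-identityˡ _)))

  -- The last j letters before position p + j are replaced by arbitrary fresh ones: this does not
  -- affect the hit at t ≤ p, whereas few of the choices produce a hit at p + j.
  pair-bound : ∀ t p r → t ≤ p → n ≤ 4 * (n ∸ (p + r + j) ∸ j) →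
    n ^ k * ∑ (words n (p + j + r)) (λ z → ∑ (words n j) (λ x → hits t z x * hits (p + j) z x))
      ≤ c₀ * 4 ^ j * totalHits (p + j + r) t
  pair-bound t p r t≤p room = begin
    n ^ k * ∑ (words n (p + j + r)) (λ z → ∑ (words n j) (λ x → hits t z x * hits (p + j) z x))
      ≡⟨ cong (n ^ k *_) (rearrange (λ z x → hits t z x * hits (p + j) z x)) ⟩
    n ^ k * ∑ (words n p) (λ u → ∑ (words n r) (λ v → ∑ (words n j) (λ x → ∑ (words n j) (λ y →
      hits t ((u ++ y) ++ v) x * hits (p + j) ((u ++ y) ++ v) x))))
      ≡⟨ push (n ^ k) _ ⟩
    ∑ (words n p) (λ u → ∑ (words n r) (λ v → ∑ (words n j) (λ x → n ^ k * ∑ (words n j) (λ y →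
      hits t ((u ++ y) ++ v) x * hits (p + j) ((u ++ y) ++ v) x))))
      ≤⟨ ∑-mono-∈ (words n p) (λ u∈ → ∑-mono-∈ (words n r) (λ v∈ → ∑-mono-∈ (words n j) (λ x∈ →
           local u∈ v∈ x∈))) ⟩
    ∑ (words n p) (λ u → ∑ (words n r) (λ v → ∑ (words n j) (λ x → c₀ * 4 ^ j * ∑ (words n j) (λ y →
      hits t ((u ++ y) ++ v) x))))
      ≡⟨ sym (push (c₀ * 4 ^ j) _) ⟩
    c₀ * 4 ^ j * ∑ (words n p) (λ u → ∑ (words n r) (λ v → ∑ (words n j) (λ x → ∑ (words n j) (λ y →
      hits t ((u ++ y) ++ v) x))))
      ≡⟨ cong (c₀ * 4 ^ j *_) (sym (rearrange (hits t))) ⟩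
    c₀ * 4 ^ j * totalHits (p + j + r) t ∎
    where
    open ≤-Reasoning
    rearrange : (g : List (Fin n) → List (Fin n) → ℕ) →
      ∑ (words n (p + j + r)) (λ z → ∑ (words n j) (g z))
        ≡ ∑ (words n p) (λ u → ∑ (words n r) (λ v → ∑ (words n j) (λ x → ∑ (words n j) (λ y → g ((u ++ y) ++ v) x))))
    rearrange g = trans (∑-words-+ n (p + j) r _) (trans (∑-words-+ n p j _)
      (∑-cong (words n p) (λ u → ∑-rotate (words n j) (words n r) (words n j) (λ y v x → g ((u ++ y) ++ v) x))))
    push : (c : ℕ) (g : List (Fin n) → List (Fin n) → List (Fin n) → ℕ) →
      c * ∑ (words n p) (λ u → ∑ (words n r) (λ v → ∑ (words n j) (g u v)))
        ≡ ∑ (words n p) (λ u → ∑ (words n r) (λ v → ∑ (words n j) (λ x → c * g u v x)))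
    push c g = sym (trans (∑-cong (words n p) (λ u → trans (∑-cong (words n r) (λ v → ∑-*ˡ (words n j) c (g u v)))
      (∑-*ˡ (words n r) c _))) (∑-*ˡ (words n p) c _))
    module _ {u v x : List (Fin n)} (u∈ : u ∈ˡ words n p) (v∈ : v ∈ˡ words n r) (x∈ : x ∈ˡ words n j) where
      rest : List (Fin n)
      rest = (u ++ v) ++ x
      -- The two hits are separated: `Low` does not involve `y`, while `High` constrains `y`
      -- relative to `u ++ x` only.
      Low : Set
      Low = Distinct ⊥ rest × (set (take t u) ∪ set x) ∈ˡ ℱ
      low? : Dec Low
      low? = distinct? ⊥ rest ×-dec ((set (take t u) ∪ set x) ∈ℱ?)
      High : List (Fin n) → Set
      High y = Distinct (set (u ++ x)) y × (set (u ++ x) ∪ set y) ∈ˡ ℱ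
      high? : Decidable High
      high? y = distinct? (set (u ++ x)) y ×-dec ((set (u ++ x) ∪ set y) ∈ℱ?)
      take-t : ∀ y → take t ((u ++ y) ++ v) ≡ take t u
      take-t y = trans (cong (take t) (++-assoc u y v))
        (take-++-≤ t u (y ++ v) (≤-trans t≤p (≤-reflexive (sym (length-word p u∈)))))
      reorder : ∀ y → set (rest ++ y) ≡ set (((u ++ y) ++ v) ++ x)
      reorder y = trans (interleave (u ++ v) y x) (trans (set-++ ((u ++ v) ++ y) x)
        (trans (cong (_∪ set x) (interleave u y v)) (sym (set-++ ((u ++ y) ++ v) x))))
      reorder-length : ∀ y → length (rest ++ y) ≡ length (((u ++ y) ++ v) ++ x)
      reorder-length y = trans (interleave-length (u ++ v) y x) (trans (length-++ ((u ++ v) ++ y))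
        (trans (cong (_+ length x) (interleave-length u y v)) (sym (length-++ ((u ++ y) ++ v)))))
      split : ∀ y → Distinct ⊥ (((u ++ y) ++ v) ++ x) → Distinct ⊥ rest × Distinct (set rest) y
      split y d with Distinct-++⁻ ⊥ rest y (Distinct-cong ⊥ {((u ++ y) ++ v) ++ x} {rest ++ y} (sym (reorder y)) (sym (reorder-length y)) d)
      ... | d₁ , d₂ = d₁ , subst (λ B → Distinct B y) (∪-identityˡ (set rest)) d₂
      join : ∀ y → Distinct ⊥ rest → Distinct (set rest) y → Distinct ⊥ (((u ++ y) ++ v) ++ x)
      join y d₁ d₂ = Distinct-cong ⊥ {rest ++ y} {((u ++ y) ++ v) ++ x} (reorder y) (reorder-length y)
        (Distinct-++⁺ ⊥ rest y d₁ (subst (λ B → Distinct B y) (sym (∪-identityˡ (set rest))) d₂))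
      ux⊆rest : set (u ++ x) ⊆ set rest
      ux⊆rest {a} a∈ = subst (a ∈_) (trans (sym (set-++ (u ++ x) v)) (interleave u v x)) (x∈p∪q⁺ (inj₁ a∈))
      both : ∀ {y} → y ∈ˡ words n j → hits t ((u ++ y) ++ v) x * hits (p + j) ((u ++ y) ++ v) x ≤ ind low? * ind (high? y)
      both {y} y∈ = subst₂ _≤_ (ind-× (hits? t ((u ++ y) ++ v) x) (hits? (p + j) ((u ++ y) ++ v) x)) (ind-× low? (high? y))
        (ind-mono (hits? t ((u ++ y) ++ v) x ×-dec hits? (p + j) ((u ++ y) ++ v) x) (low? ×-dec high? y)
          λ ((d , m) , (_ , m′)) → (proj₁ (split y d) , subst (λ w → (set w ∪ set x) ∈ˡ ℱ) (take-t y) m) ,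
            (Distinct-⊆ _ _ ux⊆rest y (proj₂ (split y d)) , subst (_∈ˡ ℱ) (upper y∈) m′))
        where
        upper : ∀ {y} → y ∈ˡ words n j → set (take (p + j) ((u ++ y) ++ v)) ∪ set x ≡ set (u ++ x) ∪ set y
        upper {y} y∈ = trans (cong (λ w → set w ∪ set x) (take-++-exact (p + j) (u ++ y) v
            (trans (length-++ u) (cong₂ _+_ (length-word p u∈) (length-word j y∈)))))
          (trans (sym (set-++ (u ++ y) x)) (trans (interleave u x y) (set-++ (u ++ x) y)))
      -- Conversely, a hit at `t` survives every choice of fresh letters `y`. By `room-for` a
      -- proportion of at least `1 / 4 ^ j` of all `y` is fresh, so `n ^ j` can be traded for
      -- `4 ^ j` times the number of hits at `t`.
      lower : ∀ y → ind low? * ind (distinct? (set rest) y) ≤ hits t ((u ++ y) ++ v) x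
      lower y = ≤-trans (≤-reflexive (sym (ind-× low? (distinct? (set rest) y))))
        (ind-mono (low? ×-dec distinct? (set rest) y) (hits? t ((u ++ y) ++ v) x)
          λ ((d , m) , d′) → join y d d′ , subst (λ w → (set w ∪ set x) ∈ˡ ℱ) (sym (take-t y)) m)
      room-for : Distinct ⊥ rest → n ^ j ≤ 4 ^ j * ∑ (words n j) (λ y → ind (distinct? (set rest) y))
      room-for d = ≤-trans
        (falling-≥ n (n ∸ ∣ set rest ∣) j (subst (λ s → n ≤ 4 * (n ∸ s ∸ j)) (sym size) room))
        (≤-reflexive (cong (4 ^ j *_) (sym (count-distinct j (set rest)))))
        where
        size : ∣ set rest ∣ ≡ p + r + j
        size = trans (cong ∣_∣ (sym (∪-identityˡ (set rest)))) (trans d (trans (cong (_+ length rest) (∣⊥∣≡0 n))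
          (trans (length-++ (u ++ v)) (cong₂ _+_ (trans (length-++ u) (cong₂ _+_ (length-word p u∈) (length-word r v∈)))
            (length-word j x∈)))))
      local : n ^ k * ∑ (words n j) (λ y → hits t ((u ++ y) ++ v) x * hits (p + j) ((u ++ y) ++ v) x)
        ≤ c₀ * 4 ^ j * ∑ (words n j) (λ y → hits t ((u ++ y) ++ v) x)
      local = begin
        n ^ k * ∑ (words n j) (λ y → hits t ((u ++ y) ++ v) x * hits (p + j) ((u ++ y) ++ v) x)
          ≤⟨ *-monoʳ-≤ (n ^ k) (∑-mono-∈ (words n j) both) ⟩
        n ^ k * ∑ (words n j) (λ y → ind low? * ind (high? y))
          ≡⟨ trans (cong (n ^ k *_) (∑-*ˡ (words n j) (ind low?) _)) (swapˡ (n ^ k) (ind low?) _) ⟩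
        ind low? * (n ^ k * ∑ (words n j) (λ y → ind (high? y)))
          -- The local bound is applied to the single set spelled by all of `u ++ x`.
          ≤⟨ *-monoʳ-≤ (ind low?) (word-extension-bound (u ++ x) high? (λ (d , m) → d , length (u ++ x) ,
               subst (λ w → (set w ∪ _) ∈ˡ ℱ) (sym (take-all (length (u ++ x)) (u ++ x) ≤-refl)) m)) ⟩
        ind low? * (c₀ * n ^ j)
          ≤⟨ enlarge low? ⟩
        ind low? * (c₀ * (4 ^ j * ∑ (words n j) (λ y → ind (distinct? (set rest) y))))
          ≡⟨ trans (cong (ind low? *_) (sym (*-assoc c₀ (4 ^ j) _))) (swapˡ (ind low?) (c₀ * 4 ^ j) _) ⟩
        c₀ * 4 ^ j * (ind low? * ∑ (words n j) (λ y → ind (distinct? (set rest) y)))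
          ≡⟨ cong (c₀ * 4 ^ j *_) (sym (∑-*ˡ (words n j) (ind low?) _)) ⟩
        c₀ * 4 ^ j * ∑ (words n j) (λ y → ind low? * ind (distinct? (set rest) y))
          ≤⟨ *-monoʳ-≤ (c₀ * 4 ^ j) (∑-mono (words n j) lower) ⟩
        c₀ * 4 ^ j * ∑ (words n j) (λ y → hits t ((u ++ y) ++ v) x) ∎
        where
        swapˡ : ∀ a b c → a * (b * c) ≡ b * (a * c)
        swapˡ a b c = trans (sym (*-assoc a b c)) (trans (cong (_* c) (*-comm a b)) (*-assoc b a c))
        enlarge : (d : Dec Low) → ind d * (c₀ * n ^ j)
          ≤ ind d * (c₀ * (4 ^ j * ∑ (words n j) (λ y → ind (distinct? (set rest) y))))
        enlarge (no _)        = z≤n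
        enlarge (yes (d , _)) = *-monoʳ-≤ 1 (*-monoʳ-≤ c₀ (room-for d))

  -- The gap of `j` lets `t′` be written as `p + j` with `t ≤ p`, so that the replaced block lies
  -- after position `t`.
  pair-bound-at : ∀ L t t′ → t + j ≤ t′ → t′ ≤ L → n ≤ 4 * (n ∸ L ∸ j) →
    n ^ k * ∑ (words n L) (λ z → ∑ (words n j) (λ x → hits t z x * hits t′ z x)) ≤ c₀ * 4 ^ j * totalHits L t
  pair-bound-at L t t′ gap t′≤L room with m≤n⇒∃[o]m+o≡n gap | m≤n⇒∃[o]m+o≡n t′≤L
  ... | o , refl | r , refl = subst (λ s → n ^ k * ∑ (words n (s + r)) (λ z → ∑ (words n j) (λ x → hits t z x * hits s z x))
        ≤ c₀ * 4 ^ j * totalHits (s + r) t) (sym shuffle)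
        (pair-bound t (t + o) r (m≤m+n t o) (subst (λ s → n ≤ 4 * (n ∸ s ∸ j)) total room))
    where
    open +-*-Solver
    shuffle : t + j + o ≡ t + o + j
    shuffle = solve 3 (λ t j o → t :+ j :+ o := t :+ o :+ j) refl t j o
    total : t + j + o + r ≡ t + o + r + j
    total = solve 4 (λ t j o r → t :+ j :+ o :+ r := t :+ o :+ r :+ j) refl t j o r

  spelled-hits : Unique ℱ → ∀ t z x → ∑ ℱ (λ A → ind (spells? t A z x)) ≤ hits t z x
  spelled-hits uniq t z x with hits? t z x
  ... | yes _ = ≤-trans
          (∑-mono ℱ (λ A → ≤-trans (ind-mono (spells? t A z x) (A ≟ˢ S) (sym ∘ proj₂)) (≤-reflexive (sym (*-identityˡ _)))))
          (∑-pin _≟ˢ_ uniq (λ _ → 1) S)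
    where
    S : Subset n
    S = set (take t z) ∪ set x
  ... | no ¬h = ≤-trans
          (∑-mono-∈ ℱ (λ {A} A∈ → ≤-reflexive (ind-no (spells? t A z x) (λ (d , e) → ¬h (d , subst (_∈ˡ ℱ) (sym e) A∈)))))
          (≤-reflexive (∑-zero ℱ))

  -- Positions are `ρ + i * Q` for `i` below `N`; `j≤Q` separates them enough for `pair-bound-at`.
  -- `room` and `fits` leave letters for the replacements and the words, `β` bounds the binomial
  -- coefficients, and `few` lets the pairs be absorbed.
  module Layers (ρ Q N β : ℕ) (uniq : Unique ℱ) (j≤Q : j ≤ Q)
    (layer : ∀ {A} → A ∈ˡ ℱ → (∃ λ i → i < N × ∣ A ∣ ≡ ρ + i * Q + j) × n C ∣ A ∣ ≤ β)
    (room : n ≤ 4 * (n ∸ (ρ + N * Q) ∸ j)) (fits : ρ + N * Q + j ≤ n)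
    (few : 2 * (N * (c₀ * 4 ^ j)) ≤ n ^ k) where

    L D W T : ℕ
    L = ρ + N * Q
    D = c₀ * 4 ^ j
    W = falling n (L + j)
    t : ℕ → ℕ
    t i = ρ + i * Q
    T = ∑ (downFrom N) (λ i → totalHits L (t i))

    t≤L : ∀ {i} → i < N → t i ≤ L
    t≤L i<N = +-monoʳ-≤ ρ (*-monoˡ-≤ Q (<⇒≤ i<N))

    t-gap : ∀ {i i′} → i < i′ → t i + j ≤ t i′
    t-gap {i} {i′} i<i′ = begin
      ρ + i * Q + j    ≤⟨ +-monoʳ-≤ (ρ + i * Q) j≤Q ⟩
      ρ + i * Q + Q    ≡⟨ +-assoc ρ (i * Q) Q ⟩
      ρ + (i * Q + Q)  ≡⟨ cong (ρ +_) (+-comm (i * Q) Q) ⟩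
      ρ + suc i * Q    ≤⟨ +-monoʳ-≤ ρ (*-monoˡ-≤ Q i<i′) ⟩
      ρ + i′ * Q       ∎
      where open ≤-Reasoning

    -- A random word spells `A` at its position with probability at least `1 / (n C ∣ A ∣)`; here
    -- this is multiplied by the number `W` of words and compared with `1 / β`.
    member-weight : ∀ {A} → A ∈ˡ ℱ →
      W ≤ β * ∑ (downFrom N) (λ i → ∑ (words n L) (λ z → ∑ (words n j) (λ x → ind (spells? (t i) A z x))))
    member-weight {A} A∈ with layer A∈
    ... | (i , i<N , size) , C≤β with m≤n⇒∃[o]m+o≡n (t≤L i<N)
    ...   | r , t+r≡L = begin
        falling n (L + j)
          ≡⟨ cong (falling n) (trans (cong (_+ j) (sym t+r≡L)) (trans
               (solve 3 (λ t r j → t :+ r :+ j := t :+ j :+ r) refl (t i) r j) (cong (_+ r) (sym size)))) ⟩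
        falling n (∣ A ∣ + r)
          ≡⟨ falling-+ n ∣ A ∣ r ⟩
        falling n ∣ A ∣ * falling (n ∸ ∣ A ∣) r
          ≡⟨ cong (_* falling (n ∸ ∣ A ∣) r) (falling-C (∣p∣≤n A)) ⟩
        (n C ∣ A ∣) * falling ∣ A ∣ ∣ A ∣ * falling (n ∸ ∣ A ∣) r
          ≡⟨ *-assoc (n C ∣ A ∣) _ _ ⟩
        (n C ∣ A ∣) * (falling ∣ A ∣ ∣ A ∣ * falling (n ∸ ∣ A ∣) r)
          ≤⟨ *-mono-≤ C≤β (spelling-count (t i) r j A size) ⟩
        β * ∑ (words n (t i + r)) (λ z → ∑ (words n j) (λ x → ind (spells? (t i) A z x)))
          ≡⟨ cong (λ l → β * ∑ (words n l) (λ z → ∑ (words n j) (λ x → ind (spells? (t i) A z x)))) t+r≡L ⟩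
        β * ∑ (words n L) (λ z → ∑ (words n j) (λ x → ind (spells? (t i) A z x)))
          ≤⟨ *-monoʳ-≤ β (∑-member (downFrom N) _ (∈-downFrom⁺ i<N)) ⟩
        β * ∑ (downFrom N) (λ i → ∑ (words n L) (λ z → ∑ (words n j) (λ x → ind (spells? (t i) A z x)))) ∎
      where
      open ≤-Reasoning
      open +-*-Solver

    family-weight : length ℱ * W ≤ β * T
    family-weight = begin
      length ℱ * W
        ≡⟨ sym (∑-const ℱ W) ⟩
      ∑ ℱ (λ _ → W)
        ≤⟨ ∑-mono-∈ ℱ member-weight ⟩
      ∑ ℱ (λ A → β * ∑ (downFrom N) (λ i → ∑ (words n L) (λ z → ∑ (words n j) (λ x → ind (spells? (t i) A z x)))))
        ≡⟨ trans (∑-*ˡ ℱ β _) (cong (β *_) (∑-swap ℱ (downFrom N) _)) ⟩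
      β * ∑ (downFrom N) (λ i → ∑ ℱ (λ A → ∑ (words n L) (λ z → ∑ (words n j) (λ x → ind (spells? (t i) A z x)))))
        ≡⟨ cong (β *_) (∑-cong (downFrom N) (λ i → ∑-rotate ℱ (words n L) (words n j) _)) ⟩
      β * ∑ (downFrom N) (λ i → ∑ (words n L) (λ z → ∑ (words n j) (λ x → ∑ ℱ (λ A → ind (spells? (t i) A z x)))))
        ≤⟨ *-monoʳ-≤ β (∑-mono (downFrom N) (λ i → ∑-mono (words n L) (λ z → ∑-mono (words n j) (λ x →
             spelled-hits uniq (t i) z x)))) ⟩
      β * T ∎
      where open ≤-Reasoning

    positions : List ℕ
    positions = map t (downFrom N)

    some : ℕ
    some = ∑ (words n L) (λ z → ∑ (words n j) (λ x → ind (hitsSome? positions z x)))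

    pairs : ℕ → ℕ → ℕ
    pairs i′ i = ∑ (words n L) (λ z → ∑ (words n j) (λ x → hits (t i) z x * hits (t i′) z x))

    hits-decompose : T ≤ some + ∑ (downFrom N) (λ i′ → ∑ (downFrom i′) (pairs i′))
    hits-decompose = begin
      T
        ≡⟨ ∑-rotate (downFrom N) (words n L) (words n j) (λ i z x → hits (t i) z x) ⟩
      ∑ (words n L) (λ z → ∑ (words n j) (λ x → ∑ (downFrom N) (λ i → hits (t i) z x)))
        ≤⟨ ∑-mono (words n L) (λ z → ∑-mono (words n j) (λ x → first-or-pair N (λ i → hits (t i) z x) _
             (λ i → ind≤1 (hits? (t i) z x))
             (λ {i} i<N → ind-mono (hits? (t i) z x) (hitsSome? positions z x)
               (λ (d , m) → d , lose (∈-map⁺ t (∈-downFrom⁺ i<N)) m)))) ⟩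
      ∑ (words n L) (λ z → ∑ (words n j) (λ x → ind (hitsSome? positions z x) + pp z x))
        ≡⟨ trans (∑-cong (words n L) (λ z → ∑-+ (words n j) _ _)) (∑-+ (words n L) _ _) ⟩
      some + ∑ (words n L) (λ z → ∑ (words n j) (pp z))
        ≡⟨ cong (some +_) (sym (trans
             (∑-cong (downFrom N) (λ i′ → ∑-rotate (downFrom i′) (words n L) (words n j) (λ i z x → hits (t i) z x * hits (t i′) z x)))
             (∑-rotate (downFrom N) (words n L) (words n j) (λ i′ z x → ∑ (downFrom i′) (λ i → hits (t i) z x * hits (t i′) z x))))) ⟩
      some + ∑ (downFrom N) (λ i′ → ∑ (downFrom i′) (pairs i′)) ∎
      where
      open ≤-Reasoning
      pp : List (Fin n) → List (Fin n) → ℕ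
      pp z x = ∑ (downFrom N) (λ i′ → ∑ (downFrom i′) (λ i → hits (t i) z x * hits (t i′) z x))

    pairs-bound : n ^ k * ∑ (downFrom N) (λ i′ → ∑ (downFrom i′) (pairs i′)) ≤ N * D * T
    pairs-bound = begin
      n ^ k * ∑ (downFrom N) (λ i′ → ∑ (downFrom i′) (pairs i′))
        ≡⟨ sym (trans (∑-cong (downFrom N) (λ i′ → ∑-*ˡ (downFrom i′) (n ^ k) _)) (∑-*ˡ (downFrom N) (n ^ k) _)) ⟩
      ∑ (downFrom N) (λ i′ → ∑ (downFrom i′) (λ i → n ^ k * pairs i′ i))
        -- Each pair is bounded by the hits at its earlier position, so each of the `N` later
        -- positions costs at most `D * T`.
        ≤⟨ ∑-≤-const (downFrom N) (D * T) (λ {i′} i′∈ → begin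
             ∑ (downFrom i′) (λ i → n ^ k * pairs i′ i)
               ≤⟨ ∑-mono-∈ (downFrom i′) (λ {i} i∈ →
                    pair-bound-at L (t i) (t i′) (t-gap (∈-downFrom⁻ i∈)) (t≤L (∈-downFrom⁻ i′∈)) room) ⟩
             ∑ (downFrom i′) (λ i → D * totalHits L (t i))
               ≡⟨ ∑-*ˡ (downFrom i′) D _ ⟩
             D * ∑ (downFrom i′) (λ i → totalHits L (t i))
               ≤⟨ *-monoʳ-≤ D (∑-downFrom-mono (λ i → totalHits L (t i)) (<⇒≤ (∈-downFrom⁻ i′∈))) ⟩
             D * T ∎) ⟩
      length (downFrom N) * (D * T)
        ≡⟨ trans (cong (_* (D * T)) (length-downFrom N)) (sym (*-assoc N D T)) ⟩
      N * D * T ∎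
      where open ≤-Reasoning

    -- The `n ^ j` tuples `x` of the local bound are compared, at the cost of `4 ^ j`, with the
    -- tuples fresh for a given `z`, so that the total becomes `W`.
    some-bound : n ^ k * some ≤ D * W
    some-bound = begin
      n ^ k * some
        ≤⟨ hitsSome-bound L positions ⟩
      falling n L * (c₀ * n ^ j)
        ≤⟨ *-monoʳ-≤ (falling n L) (*-monoʳ-≤ c₀ (falling-≥ n (n ∸ L) j room)) ⟩
      falling n L * (c₀ * (4 ^ j * falling (n ∸ L) j))
        ≡⟨ solve 4 (λ a b c d → a :* (b :* (c :* d)) := b :* c :* (a :* d)) refl (falling n L) c₀ (4 ^ j) (falling (n ∸ L) j) ⟩
      D * (falling n L * falling (n ∸ L) j)
        ≡⟨ cong (D *_) (sym (falling-+ n L j)) ⟩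
      D * W ∎
      where
      open ≤-Reasoning
      open +-*-Solver

    -- The pairs account for at most half of the hits.
    hits-bound : n ^ k * T ≤ 2 * (D * W)
    hits-bound = +-cancelʳ-≤ (n ^ k * T) _ _ (begin
      n ^ k * T + n ^ k * T
        ≡⟨ solve 1 (λ a → a :+ a := con 2 :* a) refl (n ^ k * T) ⟩
      2 * (n ^ k * T)
        ≤⟨ *-monoʳ-≤ 2 (≤-trans (*-monoʳ-≤ (n ^ k) hits-decompose) (≤-reflexive (*-distribˡ-+ (n ^ k) some _))) ⟩
      2 * (n ^ k * some + n ^ k * ∑ (downFrom N) (λ i′ → ∑ (downFrom i′) (pairs i′)))
        ≤⟨ *-monoʳ-≤ 2 (+-mono-≤ some-bound pairs-bound) ⟩
      2 * (D * W + N * D * T)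
        ≡⟨ solve 3 (λ a b c → con 2 :* (a :+ b :* c) := con 2 :* a :+ con 2 :* b :* c) refl (D * W) (N * D) T ⟩
      2 * (D * W) + 2 * (N * D) * T
        ≤⟨ +-monoʳ-≤ (2 * (D * W)) (*-monoˡ-≤ T few) ⟩
      2 * (D * W) + n ^ k * T ∎)
      where
      open ≤-Reasoning
      open +-*-Solver

    layers-bound : length ℱ * n ^ k ≤ 2 * D * β
    layers-bound = *-cancelʳ-≤ _ _ W {{>-nonZero (falling-pos (L + j) fits)}} (begin
      length ℱ * n ^ k * W
        ≡⟨ solve 3 (λ a b c → a :* b :* c := b :* (a :* c)) refl (length ℱ) (n ^ k) W ⟩
      n ^ k * (length ℱ * W)
        ≤⟨ *-monoʳ-≤ (n ^ k) family-weight ⟩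
      n ^ k * (β * T)
        ≡⟨ solve 3 (λ a b c → a :* (b :* c) := b :* (a :* c)) refl (n ^ k) β T ⟩
      β * (n ^ k * T)
        ≤⟨ *-monoʳ-≤ β hits-bound ⟩
      β * (2 * (D * W))
        ≡⟨ solve 3 (λ b d w → b :* (con 2 :* (d :* w)) := con 2 :* d :* b :* w) refl β D W ⟩
      2 * D * β * W ∎)
      where
      open ≤-Reasoning
      open +-*-Solver

-- Binomial coefficients

-- Expanding `falling n (suc a)` in two ways compares consecutive coefficients: their ratio is
-- `(n ∸ a) / suc a`, which is at least 1 here.
C-step : ∀ {n} a → suc (a + a) ≤ n → n C a ≤ n C suc a
C-step {n} a le = *-cancelʳ-≤ (n C a) (n C suc a) (suc a * a !) {{m*n≢0 (suc a) (a !) {{_}} {{a !≢0}}}} (begin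
  (n C a) * (suc a * a !)          ≤⟨ *-monoʳ-≤ (n C a) (*-monoˡ-≤ (a !) (m+n≤o⇒m≤o∸n (suc a) le)) ⟩
  (n C a) * ((n ∸ a) * a !)        ≡⟨ solve 3 (λ b c d → b :* (c :* d) := b :* d :* (c :* con 1)) refl (n C a) (n ∸ a) (a !) ⟩
  (n C a) * a ! * ((n ∸ a) * 1)    ≡⟨ cong (_* ((n ∸ a) * 1)) (sym (trans (falling-C a≤n) (cong ((n C a) *_) (falling-self a)))) ⟩
  falling n a * falling (n ∸ a) 1  ≡⟨ sym (falling-+ n a 1) ⟩
  falling n (a + 1)                ≡⟨ cong (falling n) (+-comm a 1) ⟩
  falling n (suc a)                ≡⟨ trans (falling-C 1+a≤n) (cong ((n C suc a) *_) (falling-self (suc a))) ⟩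
  (n C suc a) * (suc a * a !)      ∎)
  where
  open ≤-Reasoning
  open +-*-Solver
  1+a≤n : suc a ≤ n
  1+a≤n = ≤-trans (s≤s (m≤m+n a a)) le
  a≤n : a ≤ n
  a≤n = <⇒≤ 1+a≤n

C-mono : ∀ {n} a m → a ≤ m → m + m ≤ n → n C a ≤ n C m
C-mono a zero    z≤n  _  = ≤-refl
C-mono a (suc m) a≤sm le with m≤n⇒m<n∨m≡n a≤sm
... | inj₂ refl = ≤-refl
... | inj₁ a<sm = ≤-trans (C-mono a m (s≤s⁻¹ a<sm) (≤-trans (+-mono-≤ (n≤1+n m) (n≤1+n m)) le))
                    (C-step m (≤-trans (s≤s (+-monoʳ-≤ m (n≤1+n m))) le))

half+half≤ : ∀ n → n / 2 + n / 2 ≤ n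
half+half≤ n = ≤-trans (≤-reflexive (solve 1 (λ a → a :+ a := a :* con 2) refl (n / 2))) (m/n*n≤m n 2)
  where open +-*-Solver

C-central : ∀ n {a} → a ≤ n / 2 → n C a ≤ n C (n / 2)
C-central n a≤ = C-mono _ (n / 2) a≤ (half+half≤ n)

C-central-pos : ∀ n → 1 ≤ n C (n / 2)
C-central-pos n = ≤-trans (≤-reflexive (sym nC0)) (C-central n z≤n)
  where
  nC0 : n C 0 ≡ 1
  nC0 = trans (sym (*-identityʳ _)) (sym (falling-C {0} {n} z≤n))

-- Families of sets of size at most n / 2

unique-length : {𝒜 : List (Subset n)} → Unique 𝒜 → {W : Set} (ws : List W) (f : W → Subset n) →
  (∀ {A} → A ∈ˡ 𝒜 → ∃ λ w → w ∈ˡ ws × f w ≡ A) → length 𝒜 ≤ length ws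
unique-length {𝒜 = 𝒜} uniq ws f cover = begin
  length 𝒜                                        ≡⟨ length-∑ 𝒜 ⟩
  ∑ 𝒜 (λ _ → 1)                                   ≤⟨ ∑-mono-∈ 𝒜 (λ {A} A∈ → let w , w∈ , e = cover A∈ in
                                                       ∑-member-pos ws _ w∈ (≤-reflexive (sym (ind-yes (A ≟ˢ f w) (sym e))))) ⟩
  ∑ 𝒜 (λ A → ∑ ws (λ w → ind (A ≟ˢ f w)))         ≡⟨ ∑-swap 𝒜 ws _ ⟩
  ∑ ws (λ w → ∑ 𝒜 (λ A → ind (A ≟ˢ f w)))         ≤⟨ ∑-≤-const ws 1 (λ {w} _ → ≤-trans
                                                       (∑-mono 𝒜 (λ A → ≤-reflexive (sym (*-identityˡ _))))
                                                       (∑-pin _≟ˢ_ uniq (λ _ → 1) (f w))) ⟩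
  length ws * 1                                    ≡⟨ *-identityʳ _ ⟩
  length ws                                        ∎
  where open ≤-Reasoning

family-length : {𝒜 : List (Subset n)} → Unique 𝒜 → length 𝒜 ≤ 2 ^ n
family-length {n} uniq = ≤-trans
  (unique-length uniq (subsets n) (λ A → A) (λ {A} _ → A , subsets-complete A , refl))
  (≤-reflexive (length-subsets n))

word-of : (A : Subset n) → ∃ λ w → w ∈ˡ words n ∣ A ∣ × set w ≡ A
word-of {n} A with ∑-positive (words n ∣ A ∣) (λ w → ind (distinct? (∁ A) w))
                     (≤-trans (falling-pos ∣ A ∣ ≤-refl) (≤-reflexive (sym (count-words-of A))))
... | w , w∈ , pos = w , w∈ , Distinct-∁⇒set A w (length-word ∣ A ∣ w∈) (positive (distinct? (∁ A) w) pos)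
  where
  positive : {P : Set} (d : Dec P) → 1 ≤ ind d → P
  positive (yes p) _ = p

-- Sets below size `j` cannot contain `j` distinct letters `x` and are counted crudely, by the words
-- spelling them.
small-sets : {𝒜 : List (Subset n)} → Unique 𝒜 → 1 ≤ n → (∀ {A} → A ∈ˡ 𝒜 → ∣ A ∣ < j) → length 𝒜 ≤ j * n ^ j
small-sets {n} {j} uniq 1≤n small = begin
  _                                             ≤⟨ unique-length uniq ws set cover ⟩
  length ws                                     ≡⟨ trans (length-∑ ws) (∑-concatMap (words n) (downFrom j) _) ⟩
  ∑ (downFrom j) (λ l → ∑ (words n l) (λ _ → 1)) ≤⟨ ∑-≤-const (downFrom j) (n ^ j) (λ {l} l∈ → begin
    ∑ (words n l) (λ _ → 1)    ≡⟨ sym (length-∑ (words n l)) ⟩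
    length (words n l)         ≡⟨ trans (length-map toList (tuples n l)) (trans (length-vecs (allFin n) l) (cong (_^ l) (length-allFin n))) ⟩
    n ^ l                      ≤⟨ ^-monoʳ-≤ n {{>-nonZero 1≤n}} (<⇒≤ (∈-downFrom⁻ l∈)) ⟩
    n ^ j                      ∎) ⟩
  length (downFrom j) * n ^ j                   ≡⟨ cong (_* n ^ j) (length-downFrom j) ⟩
  j * n ^ j                                     ∎
  where
  open ≤-Reasoning
  ws : List (List (Fin n))
  ws = concatMap (words n) (downFrom j)
  cover : ∀ {A} → A ∈ˡ _ → ∃ λ w → w ∈ˡ ws × set w ≡ A
  cover {A} A∈ = let w , w∈ , e = word-of A in w , ∈-concatMap⁺ (words n) (lose (∈-downFrom⁺ (small A∈)) w∈) , e

-- A power of `n` is compared with `n C K` and then with the central coefficient; this makes the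
-- small sets negligible.
power≤C : ∀ n K → K ≤ n / 2 → n ^ K ≤ 4 ^ K * K ! * (n C (n / 2))
power≤C n K K≤ = begin
  n ^ K                                ≤⟨ falling-≥ n n K room ⟩
  4 ^ K * falling n K                  ≡⟨ cong (4 ^ K *_) (trans (falling-C K≤n) (cong ((n C K) *_) (falling-self K))) ⟩
  4 ^ K * ((n C K) * K !)              ≤⟨ *-monoʳ-≤ (4 ^ K) (*-monoˡ-≤ (K !) (C-central n K≤)) ⟩
  4 ^ K * ((n C (n / 2)) * K !)        ≡⟨ solve 3 (λ a b c → a :* (b :* c) := a :* c :* b) refl (4 ^ K) (n C (n / 2)) (K !) ⟩
  4 ^ K * K ! * (n C (n / 2))          ∎
  where
  open ≤-Reasoning
  open +-*-Solver
  2K≤n : K + K ≤ n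
  2K≤n = ≤-trans (+-mono-≤ K≤ K≤) (half+half≤ n)
  K≤n : K ≤ n
  K≤n = ≤-trans (m≤m+n K K) 2K≤n
  K≤n∸K : K ≤ n ∸ K
  K≤n∸K = m+n≤o⇒m≤o∸n K 2K≤n
  room : n ≤ 4 * (n ∸ K)
  room = begin
    n                        ≡⟨ sym (m∸n+n≡m K≤n) ⟩
    n ∸ K + K                ≤⟨ +-monoʳ-≤ (n ∸ K) K≤n∸K ⟩
    n ∸ K + (n ∸ K)          ≤⟨ m≤m+n _ (2 * (n ∸ K)) ⟩
    n ∸ K + (n ∸ K) + 2 * (n ∸ K) ≡⟨ solve 1 (λ a → a :+ a :+ con 2 :* a := con 4 :* a) refl (n ∸ K) ⟩
    4 * (n ∸ K)              ∎

AvoidsDiff-filter : {𝒜 : List (Subset n)} {P : Subset n → Set} (P? : Decidable P) →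
  AvoidsDiff k 𝒜 → AvoidsDiff k (filter P? 𝒜)
AvoidsDiff-filter P? av A∈ B∈ = av (proj₁ (∈-filter⁻ P? A∈)) (proj₁ (∈-filter⁻ P? B∈))

-- `j₁` is the least value allowed by the local bound. `Q₁` exceeds `j₁`, for the spacing, and
-- `2 * D₁`, for `few`. `K₁` is the power of `n` arising from the small sets, and `threshold` gives
-- `12 * Q₁ ≤ n` and `2 * K₁ ≤ n`. In `lowConstant` the small sets are followed by the `Q₁` residue
-- classes.
module Constants (k′ : ℕ) where

  k₁ j₁ D₁ Q₁ K₁ threshold lowConstant : ℕ
  k₁ = suc k′
  j₁ = k₁ + 2 ^ k₁ * k₁
  D₁ = localConstant k₁ j₁ * 4 ^ j₁
  Q₁ = suc (2 * D₁ + j₁)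
  K₁ = j₁ + k₁
  threshold = 12 * Q₁ + 2 * K₁
  lowConstant = j₁ * (4 ^ K₁ * K₁ !) + Q₁ * (2 * D₁)

module Low (k′ n : ℕ) (large : Constants.threshold k′ ≤ n) where
  open Constants k′

  -- Sizes up to `n / 2` only need indices up to `n / (2 * Q₁)`.
  N : ℕ
  N = suc (n / (2 * Q₁))

  12Q≤n : 12 * Q₁ ≤ n
  12Q≤n = ≤-trans (m≤m+n _ (2 * K₁)) large

  1≤n : 1 ≤ n
  1≤n = ≤-trans (s≤s z≤n) 12Q≤n

  N2Q≤ : N * (2 * Q₁) ≤ n + 2 * Q₁
  N2Q≤ = ≤-trans (+-monoʳ-≤ (2 * Q₁) (m/n*n≤m n (2 * Q₁))) (≤-reflexive (+-comm (2 * Q₁) n))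

  -- `N * Q₁` is at most `n` and `2 * D₁` is below `Q₁`; `n ≤ n ^ k₁` then uses that `k₁` is
  -- positive.
  few : 2 * (N * D₁) ≤ n ^ k₁
  few = begin
    2 * (N * D₁)  ≡⟨ solve 2 (λ a b → con 2 :* (a :* b) := a :* (con 2 :* b)) refl N D₁ ⟩
    N * (2 * D₁)  ≤⟨ *-monoʳ-≤ N (≤-trans (m≤m+n (2 * D₁) j₁) (n≤1+n _)) ⟩
    N * Q₁        ≤⟨ *-cancelˡ-≤ 2 (begin
      2 * (N * Q₁)    ≡⟨ solve 2 (λ a b → con 2 :* (a :* b) := a :* (con 2 :* b)) refl N Q₁ ⟩
      N * (2 * Q₁)    ≤⟨ N2Q≤ ⟩
      n + 2 * Q₁      ≤⟨ +-monoʳ-≤ n (≤-trans (*-monoˡ-≤ Q₁ {2} {12} (s≤s (s≤s z≤n))) 12Q≤n) ⟩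
      n + n           ≡⟨ solve 1 (λ a → a :+ a := con 2 :* a) refl n ⟩
      2 * n           ∎) ⟩
    n             ≤⟨ m≤m*n n (n ^ k′) {{m^n≢0 n k′ {{>-nonZero 1≤n}}}} ⟩
    n ^ k₁        ∎
    where
    open ≤-Reasoning
    open +-*-Solver

  module _ {ρ : ℕ} (ρ<Q : ρ < Q₁) where

    -- `N * Q₁` is at most `n / 2 + Q₁`, and `ρ` and `j₁` are at most `Q₁` each; the three extra
    -- `Q₁` amount to at most `n / 4`. The remaining quarter of the ground set gives `room`.
    chain-short : 4 * (ρ + N * Q₁ + j₁) ≤ 3 * n
    chain-short = begin
      4 * (ρ + N * Q₁ + j₁)               ≤⟨ *-monoʳ-≤ 4 (+-mono-≤ (+-monoˡ-≤ (N * Q₁) (<⇒≤ ρ<Q)) (≤-trans (m≤n+m j₁ (2 * D₁)) (n≤1+n _))) ⟩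
      4 * (Q₁ + N * Q₁ + Q₁)              ≡⟨ solve 2 (λ q a → con 4 :* (q :+ a :* q :+ q) := con 8 :* q :+ con 2 :* (a :* (con 2 :* q))) refl Q₁ N ⟩
      8 * Q₁ + 2 * (N * (2 * Q₁))         ≤⟨ +-monoʳ-≤ (8 * Q₁) (*-monoʳ-≤ 2 N2Q≤) ⟩
      8 * Q₁ + 2 * (n + 2 * Q₁)           ≡⟨ solve 2 (λ q a → con 8 :* q :+ con 2 :* (a :+ con 2 :* q) := con 12 :* q :+ con 2 :* a) refl Q₁ n ⟩
      12 * Q₁ + 2 * n                     ≤⟨ +-monoˡ-≤ (2 * n) 12Q≤n ⟩
      n + 2 * n                           ≡⟨ refl ⟩
      3 * n                               ∎
      where
      open ≤-Reasoning
      open +-*-Solver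

    fits : ρ + N * Q₁ + j₁ ≤ n
    fits = *-cancelˡ-≤ 4 (≤-trans chain-short (*-monoˡ-≤ n {3} {4} (s≤s (s≤s (s≤s z≤n)))))

    room : n ≤ 4 * (n ∸ (ρ + N * Q₁) ∸ j₁)
    room = begin
      n                                   ≡⟨ sym (m+n∸n≡m n (3 * n)) ⟩
      4 * n ∸ 3 * n                       ≤⟨ ∸-monoʳ-≤ (4 * n) chain-short ⟩
      4 * n ∸ 4 * (ρ + N * Q₁ + j₁)       ≡⟨ sym (*-distribˡ-∸ 4 n (ρ + N * Q₁ + j₁)) ⟩
      4 * (n ∸ (ρ + N * Q₁ + j₁))         ≡⟨ cong (4 *_) (sym (∸-+-assoc n (ρ + N * Q₁) j₁)) ⟩
      4 * (n ∸ (ρ + N * Q₁) ∸ j₁)         ∎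
      where open ≤-Reasoning

  -- A member of size `t + j₁` is spelled at position `t`. Fixing the residue of `t` modulo `Q₁`
  -- makes distinct positions at least `Q₁` apart.
  InClass : ℕ → Subset n → Set
  InClass ρ A = j₁ ≤ ∣ A ∣ × (∣ A ∣ ∸ j₁) % Q₁ ≡ ρ

  inClass? : ∀ ρ → Decidable (InClass ρ)
  inClass? ρ A = (j₁ ≤? ∣ A ∣) ×-dec ((∣ A ∣ ∸ j₁) % Q₁ ≟ ρ)

  Small : Subset n → Set
  Small A = ∣ A ∣ < j₁

  small? : Decidable Small
  small? A = ∣ A ∣ <? j₁

  module _ {𝒜 : List (Subset n)} (uniq : Unique 𝒜) (avoid : AvoidsDiff k₁ 𝒜)
           (low : ∀ {A} → A ∈ˡ 𝒜 → ∣ A ∣ ≤ n / 2) where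

    β : ℕ
    β = n C (n / 2)

    class-bound : ∀ {ρ} → ρ < Q₁ → length (filter (inClass? ρ) 𝒜) * n ^ k₁ ≤ 2 * D₁ * β
    class-bound {ρ} ρ<Q = Layers.layers-bound ρ Q₁ N β (filter⁺ (inClass? ρ) {𝒜} uniq)
      (≤-trans (m≤n+m j₁ (2 * D₁)) (n≤1+n _)) layer (room ρ<Q) (fits ρ<Q) few
      where
      open Family k₁ j₁ ≤-refl {ℱ = filter (inClass? ρ) 𝒜} (AvoidsDiff-filter {k = k₁} {𝒜 = 𝒜} (inClass? ρ) avoid)
      layer : ∀ {A} → A ∈ˡ filter (inClass? ρ) 𝒜 → (∃ λ i → i < N × ∣ A ∣ ≡ ρ + i * Q₁ + j₁) × n C ∣ A ∣ ≤ β
      layer {A} A∈ with ∈-filter⁻ (inClass? ρ) {xs = 𝒜} A∈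
      ... | A∈𝒜 , j≤A , refl = (i , s≤s i≤ , size) , C-central n (low A∈𝒜)
        where
        i : ℕ
        i = (∣ A ∣ ∸ j₁) / Q₁
        size : ∣ A ∣ ≡ (∣ A ∣ ∸ j₁) % Q₁ + i * Q₁ + j₁
        size = trans (sym (m∸n+n≡m j≤A)) (cong (_+ j₁) (m≡m%n+[m/n]*n (∣ A ∣ ∸ j₁) Q₁))
        i2Q≤n : i * (2 * Q₁) ≤ n
        i2Q≤n = begin
          i * (2 * Q₁)        ≡⟨ solve 2 (λ a q → a :* (con 2 :* q) := a :* q :+ a :* q) refl i Q₁ ⟩
          i * Q₁ + i * Q₁     ≤⟨ +-mono-≤ iQ≤ iQ≤ ⟩
          n / 2 + n / 2       ≤⟨ half+half≤ n ⟩
          n                   ∎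
          where
          open ≤-Reasoning
          open +-*-Solver
          iQ≤ : i * Q₁ ≤ n / 2
          iQ≤ = ≤-trans (m/n*n≤m (∣ A ∣ ∸ j₁) Q₁) (≤-trans (m∸n≤m ∣ A ∣ j₁) (low A∈𝒜))
        i≤ : i ≤ n / (2 * Q₁)
        i≤ = ≤-trans (≤-reflexive (sym (m*n/n≡m i (2 * Q₁)))) (/-monoˡ-≤ (2 * Q₁) i2Q≤n)

    small-bound : length (filter small? 𝒜) * n ^ k₁ ≤ j₁ * (4 ^ K₁ * K₁ !) * β
    small-bound = begin
      length (filter small? 𝒜) * n ^ k₁    ≤⟨ *-monoˡ-≤ (n ^ k₁) (small-sets (filter⁺ small? {𝒜} uniq) 1≤n (λ A∈ → proj₂ (∈-filter⁻ small? {xs = 𝒜} A∈))) ⟩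
      j₁ * n ^ j₁ * n ^ k₁                 ≡⟨ trans (*-assoc j₁ (n ^ j₁) (n ^ k₁)) (cong (j₁ *_) (sym (^-distribˡ-+-* n j₁ k₁))) ⟩
      j₁ * n ^ K₁                          ≤⟨ *-monoʳ-≤ j₁ (power≤C n K₁ K≤half) ⟩
      j₁ * (4 ^ K₁ * K₁ ! * β)             ≡⟨ sym (*-assoc j₁ (4 ^ K₁ * K₁ !) β) ⟩
      j₁ * (4 ^ K₁ * K₁ !) * β             ∎
      where
      open ≤-Reasoning
      K≤half : K₁ ≤ n / 2
      K≤half = ≤-trans (≤-reflexive (sym (m*n/n≡m K₁ 2)))
        (/-monoˡ-≤ 2 (≤-trans (≤-reflexive (*-comm K₁ 2)) (≤-trans (m≤n+m (2 * K₁) (12 * Q₁)) large)))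

    partition : length 𝒜 ≤ length (filter small? 𝒜) + ∑ (downFrom Q₁) (λ ρ → length (filter (inClass? ρ) 𝒜))
    partition = begin
      length 𝒜
        ≡⟨ length-∑ 𝒜 ⟩
      ∑ 𝒜 (λ _ → 1)
        ≤⟨ ∑-mono 𝒜 cover ⟩
      ∑ 𝒜 (λ A → ind (small? A) + ∑ (downFrom Q₁) (λ ρ → ind (inClass? ρ A)))
        ≡⟨ trans (∑-+ 𝒜 _ _) (cong₂ _+_ (sym (length-filter-∑ small? 𝒜))
             (trans (∑-swap 𝒜 (downFrom Q₁) _) (∑-cong (downFrom Q₁) (λ ρ → sym (length-filter-∑ (inClass? ρ) 𝒜))))) ⟩
      length (filter small? 𝒜) + ∑ (downFrom Q₁) (λ ρ → length (filter (inClass? ρ) 𝒜)) ∎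
      where
      open ≤-Reasoning
      cover : ∀ A → 1 ≤ ind (small? A) + ∑ (downFrom Q₁) (λ ρ → ind (inClass? ρ A))
      cover A with small? A
      ... | yes _  = s≤s z≤n
      ... | no big = ∑-member-pos (downFrom Q₁) _ (∈-downFrom⁺ (m%n<n (∣ A ∣ ∸ j₁) Q₁))
              (≤-reflexive (sym (ind-yes (inClass? _ A) (≮⇒≥ big , refl))))

    low-bound : length 𝒜 * n ^ k₁ ≤ lowConstant * β
    low-bound = begin
      length 𝒜 * n ^ k₁
        ≤⟨ *-monoˡ-≤ (n ^ k₁) partition ⟩
      (length (filter small? 𝒜) + ∑ (downFrom Q₁) (λ ρ → length (filter (inClass? ρ) 𝒜))) * n ^ k₁
        ≡⟨ trans (*-distribʳ-+ (n ^ k₁) (length (filter small? 𝒜)) _)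
             (cong (length (filter small? 𝒜) * n ^ k₁ +_) (sym (∑-*ʳ (downFrom Q₁) (n ^ k₁) (λ ρ → length (filter (inClass? ρ) 𝒜))))) ⟩
      length (filter small? 𝒜) * n ^ k₁ + ∑ (downFrom Q₁) (λ ρ → length (filter (inClass? ρ) 𝒜) * n ^ k₁)
        ≤⟨ +-mono-≤ small-bound (∑-≤-const (downFrom Q₁) (2 * D₁ * β) (λ ρ∈ → class-bound (∈-downFrom⁻ ρ∈))) ⟩
      j₁ * (4 ^ K₁ * K₁ !) * β + length (downFrom Q₁) * (2 * D₁ * β)
        ≡⟨ cong (j₁ * (4 ^ K₁ * K₁ !) * β +_) (trans (cong (_* (2 * D₁ * β)) (length-downFrom Q₁)) (sym (*-assoc Q₁ (2 * D₁) β))) ⟩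
      j₁ * (4 ^ K₁ * K₁ !) * β + Q₁ * (2 * D₁) * β
        ≡⟨ sym (*-distribʳ-+ β (j₁ * (4 ^ K₁ * K₁ !)) (Q₁ * (2 * D₁))) ⟩
      lowConstant * β ∎
      where open ≤-Reasoning

-- Complements

-- The two sets change places. As avoidance is assumed for all ordered pairs, it passes to the
-- complements.
∁-difference : (A B : Subset n) → ∣ ∁ A ─ ∁ B ∣ ≡ ∣ B ─ A ∣
∁-difference []          []          = refl
∁-difference (true ∷ A)  (true ∷ B)  = ∁-difference A B
∁-difference (true ∷ A)  (false ∷ B) = ∁-difference A B
∁-difference (false ∷ A) (true ∷ B)  = cong suc (∁-difference A B)
∁-difference (false ∷ A) (false ∷ B) = ∁-difference A B

∁-injective : {A B : Subset n} → ∁ A ≡ ∁ B → A ≡ B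
∁-injective {A = A} {B} e = ⊆-antisym
  (λ {x} x∈A → x∉∁p⇒x∈p (λ p → x∈p⇒x∉∁p x∈A (subst (x ∈_) (sym e) p)))
  (λ {x} x∈B → x∉∁p⇒x∈p (λ p → x∈p⇒x∉∁p x∈B (subst (x ∈_) e p)))

∁-low : (A : Subset n) → ¬ (∣ A ∣ ≤ n / 2) → ∣ ∁ A ∣ ≤ n / 2
∁-low {n} A big = ≤-trans (≤-reflexive (∣∁p∣≡n∸∣p∣ A)) (m≤n+o⇒m∸n≤o n ∣ A ∣ (begin
  n                          ≡⟨ m≡m%n+[m/n]*n n 2 ⟩
  n % 2 + n / 2 * 2          ≤⟨ +-monoˡ-≤ (n / 2 * 2) (s≤s⁻¹ (m%n<n n 2)) ⟩
  1 + n / 2 * 2              ≡⟨ solve 1 (λ a → con 1 :+ a :* con 2 := con 1 :+ a :+ a) refl (n / 2) ⟩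
  suc (n / 2) + n / 2        ≤⟨ +-monoˡ-≤ (n / 2) (≰⇒> big) ⟩
  ∣ A ∣ + n / 2              ∎))
  where
  open ≤-Reasoning
  open +-*-Solver

-- Joining the two halves and the small values of n.

module Positive (k′ : ℕ) where
  open Constants k′

  -- The first summand covers `n` below the threshold, with the trivial bound `2 ^ n` on the family;
  -- the other two cover its halves. The successor makes positivity immediate.
  finalConstant : ℕ
  finalConstant = suc (2 ^ threshold * threshold ^ k₁ + (lowConstant + lowConstant))

  large-bound : ∀ n → threshold ≤ n → (𝒜 : List (Subset n)) → Unique 𝒜 → AvoidsDiff k₁ 𝒜 →
    length 𝒜 * n ^ k₁ ≤ (lowConstant + lowConstant) * (n C (n / 2))
  large-bound n large 𝒜 uniq avoid = begin
    length 𝒜 * n ^ k₁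
      ≤⟨ *-monoˡ-≤ (n ^ k₁) halves ⟩
    (length lowPart + length highPart) * n ^ k₁
      ≡⟨ *-distribʳ-+ (n ^ k₁) (length lowPart) (length highPart) ⟩
    length lowPart * n ^ k₁ + length highPart * n ^ k₁
      ≤⟨ +-mono-≤
           (Low.low-bound k′ n large (filter⁺ low? {𝒜} uniq) (AvoidsDiff-filter {k = k₁} {𝒜 = 𝒜} low? avoid) (λ A∈ → proj₂ (∈-filter⁻ low? {xs = 𝒜} A∈)))
           (Low.low-bound k′ n large (map⁺ ∁-injective (filter⁺ high? {𝒜} uniq)) avoid-high low-high) ⟩
    lowConstant * (n C (n / 2)) + lowConstant * (n C (n / 2))
      ≡⟨ sym (*-distribʳ-+ (n C (n / 2)) lowConstant lowConstant) ⟩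
    (lowConstant + lowConstant) * (n C (n / 2)) ∎
    where
    open ≤-Reasoning
    low? : Decidable (λ (A : Subset n) → ∣ A ∣ ≤ n / 2)
    low? A = ∣ A ∣ ≤? n / 2
    high? : Decidable (λ (A : Subset n) → ¬ (∣ A ∣ ≤ n / 2))
    high? A = ¬? (low? A)
    lowPart highPart : List (Subset n)
    lowPart = filter low? 𝒜
    highPart = map ∁ (filter high? 𝒜)
    halves : length 𝒜 ≤ length lowPart + length highPart
    halves = begin
      length 𝒜                                        ≡⟨ length-∑ 𝒜 ⟩
      ∑ 𝒜 (λ _ → 1)                                   ≤⟨ ∑-mono 𝒜 cover ⟩
      ∑ 𝒜 (λ A → ind (low? A) + ind (high? A))        ≡⟨ ∑-+ 𝒜 _ _ ⟩
      ∑ 𝒜 (λ A → ind (low? A)) + ∑ 𝒜 (λ A → ind (high? A))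
        ≡⟨ cong₂ _+_ (sym (length-filter-∑ low? 𝒜))
             (trans (sym (length-filter-∑ high? 𝒜)) (sym (length-map ∁ (filter high? 𝒜)))) ⟩
      length lowPart + length highPart ∎
      where
      cover : ∀ A → 1 ≤ ind (low? A) + ind (high? A)
      cover A with low? A
      ... | yes _ = s≤s z≤n
      ... | no _  = s≤s z≤n
    avoid-high : AvoidsDiff k₁ highPart
    avoid-high A∈ B∈ with ∈-map⁻ ∁ A∈ | ∈-map⁻ ∁ B∈
    ... | A , A∈′ , refl | B , B∈′ , refl = λ e →
      avoid (proj₁ (∈-filter⁻ high? {xs = 𝒜} B∈′)) (proj₁ (∈-filter⁻ high? {xs = 𝒜} A∈′)) (trans (sym (∁-difference A B)) e)
    low-high : ∀ {A} → A ∈ˡ highPart → ∣ A ∣ ≤ n / 2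
    low-high A∈ with ∈-map⁻ ∁ A∈
    ... | A , A∈′ , refl = ∁-low A (proj₂ (∈-filter⁻ high? {xs = 𝒜} A∈′))

  final-bound : ∀ n → (𝒜 : List (Subset n)) → Unique 𝒜 → AvoidsDiff k₁ 𝒜 →
    length 𝒜 * n ^ k₁ ≤ finalConstant * (n C (n / 2))
  final-bound n 𝒜 uniq avoid with threshold ≤? n
  ... | yes large = ≤-trans (large-bound n large 𝒜 uniq avoid)
          (*-monoˡ-≤ (n C (n / 2)) (m≤n⇒m≤1+n (m≤n+m (lowConstant + lowConstant) (2 ^ threshold * threshold ^ k₁))))
  ... | no small = begin
      length 𝒜 * n ^ k₁                  ≤⟨ *-mono-≤ (≤-trans (family-length uniq) (^-monoʳ-≤ 2 n≤)) (^-monoˡ-≤ k₁ n≤) ⟩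
      2 ^ threshold * threshold ^ k₁     ≤⟨ m≤n⇒m≤1+n (m≤m+n _ (lowConstant + lowConstant)) ⟩
      finalConstant                      ≡⟨ sym (*-identityʳ finalConstant) ⟩
      finalConstant * 1                  ≤⟨ *-monoʳ-≤ finalConstant (C-central-pos n) ⟩
      finalConstant * (n C (n / 2))      ∎
    where
    open ≤-Reasoning
    n≤ : n ≤ threshold
    n≤ = <⇒≤ (≰⇒> small)

∣p─p∣≡0 : (A : Subset n) → ∣ A ─ A ∣ ≡ 0
∣p─p∣≡0 []          = refl
∣p─p∣≡0 (true ∷ A)  = ∣p─p∣≡0 A
∣p─p∣≡0 (false ∷ A) = ∣p─p∣≡0 A

theorem3 : (k : ℕ) → ∃ λ (c : ℕ) → 0 < c ×
    ((n : ℕ) → (𝒜 : List (Subset n)) → Unique 𝒜 → AvoidsDiff k 𝒜 →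
    length 𝒜 * n ^ k ≤ c * (n C (n / 2)))
-- For `k = 0` any member `A` violates avoidance together with itself, so the family is empty.
theorem3 zero     = 1 , s≤s z≤n , λ where
  n []      _ _     → z≤n
  n (A ∷ 𝒜) _ avoid → ⊥-elim (avoid (here refl) (here refl) (∣p─p∣≡0 A))
theorem3 (suc k′) = Positive.finalConstant k′ , s≤s z≤n , Positive.final-bound k′
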